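{- Let $f(t)\in\mathbb{C}[[t]]$ be a delta series and $r\ge1$ an integer. Put $\partial_y:=\frac{\partial}{\partial y}$. The Legendre-Gould Hopper based associated Sheffer polynomials ${}_{{}_{s}LeG^{(r)}}\mathfrak{s}_{n}(x,y,z)$ and $\frac{{}_{{}_{r}LeG^{(r)}}\mathfrak{s}_{n}(x,y,z)}{n!}$ satisfy, respectively, the differential equations $$\left(\left(y+2D_x^{ -1}\frac{\partial}{\partial y}+rz\frac{\partial^{r-1}}{\partial y^{r-1}}\right)\frac{f(\partial_y)}{f'(\partial_y)}-n\right){}_{{}_{s}LeG^{(r)}}\mathfrak{s}_{n}(x,y,z)=0$$ and $$\left(\left(-D_x^{ -1}+D_y^{ -1}+rz\frac{\partial^{r-1}}{\partial y^{r-1}}\right)\frac{f\!\left(-\frac{\partial}{\partial x}\,x\,\frac{\partial}{\partial x}\right)}{f'(\partial_y)}-n\right){}_{{}_{r}LeG^{(r)}}\mathfrak{s}_{n}(x,y,z)=0.$$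
   Context: A delta series is $f\in\mathbb{C}[[t]]$ with $f(0)=0$, $f'(0)\neq 0$; $f^{ -1}$ denotes its compositional inverse. $C_0(x)=\sum_{k\ge 0}\frac{(-1)^k x^k}{(k!)^2}$ is the Bessel-Tricomi function of order $0$. $D_x^{ -1},D_y^{ -1}$ are the inverse derivative operators in $x$ and $y$, with $D_x^{ -n}\{1\}=x^n/n!$ and $D_y^{ -n}\{1\}=y^n/n!$. Formal power series in differential operators act termwise on polynomials. The polynomials are defined by the generating functions $$C_0\!\left(-x\,(f^{ -1}(t))^2\right)\exp\!\left(y f^{ -1}(t)+z\,(f^{ -1}(t))^r\right)=\sum_{n=0}^{\infty}{}_{{}_{s}LeG^{(r)}}\mathfrak{s}_{n}(x,y,z)\frac{t^n}{n!},$$ $$C_0\!\left(x f^{ -1}(t)\right)C_0\!\left(-y f^{ -1}(t)\right)\exp\!\left(z\,(f^{ -1}(t))^r\right)=\sum_{n=0}^{\infty}{}_{{}_{r}LeG^{(r)}}\mathfrak{s}_{n}(x,y,z)\frac{t^n}{(n!)^2}.$$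
   Formalization: In the second equation ∂/∂y, both in rz∂^{r-1}/∂y^{r-1} and in f'(∂_y), is replaced by the derivative with respect to D_y^{ -1}, i.e. ∂_y y ∂_y; with the literal ∂/∂y the equation is false (e.g. f(t)=t, r=2, n=3). -}

module Defs where

open import Level using (Level; _⊔_)
open import Algebra.Bundles using (RawRing; CommutativeRing)
open import Algebra.Apartness.Bundles using (HeytingField; HeytingCommutativeRing)
import Algebra.Definitions.RawSemiring as RawSemiringDefinitions
open import Data.Nat.Base as ℕ using (ℕ; zero; suc; pred; _∸_; _!)
open import Data.Nat.Properties using (_≟_)
open import Data.Fin.Base using (toℕ)
open import Data.List.Base using (List; []; _∷_; _++_; map; foldr; cartesianProductWith)
open import Data.Bool.Base using (if_then_else_; _∧_)
open import Data.Product.Base using (_×_; proj₁)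
open import Relation.Nullary.Decidable using (⌊_⌋)
import Function.Endo.Propositional as Endomorphism

private
  variable
    c ℓ ℓ₁ ℓ₂ : Level

-- Formal power series over R in one variable t; φ n is the coefficient of t ^ n.

module PowerSeries (R : RawRing c ℓ) where

  open RawRing R
  open RawSemiringDefinitions rawSemiring public using () renaming (_×_ to _·_)
  open RawSemiringDefinitions rawSemiring public using (_^_; sum)

  Series : Set c
  Series = ℕ → Carrier

  Σ≤ : ℕ → (ℕ → Carrier) → Carrier
  Σ≤ n a = sum {suc n} (λ k → a (toℕ k))

  constant : Carrier → Series
  constant a zero    = a
  constant a (suc _) = 0#

  seriesRing : RawRing c ℓ
  seriesRing = record
    { Carrier = Series
    ; _≈_     = λ φ ψ → ∀ n → φ n ≈ ψ n
    ; _+_     = λ φ ψ n → φ n + ψ n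
    ; _*_     = λ φ ψ n → Σ≤ n (λ k → φ k * ψ (n ∸ k))
    ; -_      = λ φ n → - φ n
    ; 0#      = λ _ → 0#
    ; 1#      = constant 1#
    }

  open RawSemiringDefinitions (RawRing.rawSemiring seriesRing) using () renaming (_^_ to _^ₛ_)

  t : Series
  t (suc zero) = 1#
  t _          = 0#

  derivative : Series → Series
  derivative φ n = suc n · φ (suc n)

  -- Substitution φ(g(t)). It is only meaningful when g has zero constant term:
  -- then t ^ k divides g(t) ^ k, so the terms omitted here, those with k > n,
  -- do not contribute to the coefficient of t ^ n.
  infixr 9 _∘ₛ_
  _∘ₛ_ : Series → Series → Series
  (φ ∘ₛ g) n = Σ≤ n (λ k → φ k * (g ^ₛ k) n)

fieldRawRing : HeytingField c ℓ₁ ℓ₂ → RawRing c ℓ₁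
fieldRawRing K = CommutativeRing.rawRing (HeytingCommutativeRing.commutativeRing (HeytingField.heytingCommutativeRing K))

CharacteristicZero : HeytingField c ℓ₁ ℓ₂ → Set ℓ₂
CharacteristicZero K = ∀ n → (suc n · 1#) # 0#
  where
  open HeytingField K using (_#_; 0#; 1#)
  open PowerSeries (fieldRawRing K) using (_·_)

module LegendreGouldHopperSheffer (K : HeytingField c ℓ₁ ℓ₂) (char0 : CharacteristicZero K) where

  open HeytingField K public using () renaming (Carrier to 𝕂)
  open HeytingField K using (_≈_; _#_; _+_; _*_; -_; 0#; 1#; #⇒invertible)

  module 𝕂ₛ = PowerSeries (fieldRawRing K)
  open 𝕂ₛ public using (Series)
  open 𝕂ₛ using (_·_; _^_; t; derivative; _∘ₛ_)
  open RawRing 𝕂ₛ.seriesRing using () renaming (_≈_ to _≈ₛ_; _*_ to _*ₛ_; 1# to 1ₛ)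

  IsDelta : Series → Set (ℓ₁ ⊔ ℓ₂)
  IsDelta f = (f 0 ≈ 0#) × (derivative f 0 # 0#)

  IsCompositionalInverse : Series → Series → Set ℓ₁
  IsCompositionalInverse f g = (g 0 ≈ 0#) × ((f ∘ₛ g) ≈ₛ t) × ((g ∘ₛ f) ≈ₛ t)

  IsReciprocal : Series → Series → Set ℓ₁
  IsReciprocal φ ψ = (φ *ₛ ψ) ≈ₛ 1ₛ

  1/suc : ℕ → 𝕂
  1/suc n = proj₁ (#⇒invertible (char0 n))

  1/_! : ℕ → 𝕂
  1/ zero  ! = 1#
  1/ suc n ! = 1/suc n * 1/ n !

  expSeries : Series
  expSeries k = 1/ k !

  C₀ : Series
  C₀ k = (- 1#) ^ k * (1/ k ! * 1/ k !)

  -- A polynomial in x, y, z is a formal finite sum of terms; `mono a i j k`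
  -- stands for a x^i y^j z^k. Exponents may repeat and coefficients may vanish,
  -- so equality of polynomials is equality of all coefficients.

  record Term : Set c where
    constructor mono
    field
      coefficient : 𝕂
      degˣ degʸ degᶻ : ℕ

  Poly : Set c
  Poly = List Term

  coeff : Poly → ℕ → ℕ → ℕ → 𝕂
  coeff []                     i′ j′ k′ = 0#
  coeff (mono a i j k ∷ terms) i′ j′ k′ =
    (if ⌊ i ≟ i′ ⌋ ∧ ⌊ j ≟ j′ ⌋ ∧ ⌊ k ≟ k′ ⌋ then a else 0#) + coeff terms i′ j′ k′

  _*ₜ_ : Term → Term → Term
  mono a i j k *ₜ mono a′ i′ j′ k′ = mono (a * a′) (i ℕ.+ i′) (j ℕ.+ j′) (k ℕ.+ k′)

  scalar : 𝕂 → Poly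
  scalar a = mono a 0 0 0 ∷ []

  polyRing : RawRing c ℓ₁
  polyRing = record
    { Carrier = Poly
    ; _≈_     = λ p q → ∀ i j k → coeff p i j k ≈ coeff q i j k
    ; _+_     = _++_
    ; _*_     = cartesianProductWith _*ₜ_
    ; -_      = map (λ { (mono a i j k) → mono (- a) i j k })
    ; 0#      = []
    ; 1#      = scalar 1#
    }

  open RawRing polyRing public using () renaming
    (_≈_ to _≈ₚ_; _+_ to _+ₚ_; _*_ to _*ₚ_; -_ to -ₚ_; 0# to 0ₚ)
  module Polyₛ = PowerSeries polyRing
  open Polyₛ public using () renaming (_·_ to _·ₚ_)

  infixl 6 _-ₚ_
  _-ₚ_ : Poly → Poly → Poly
  p -ₚ q = p +ₚ (-ₚ q)

  x y z : Poly
  x = mono 1# 1 0 0 ∷ []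
  y = mono 1# 0 1 0 ∷ []
  z = mono 1# 0 0 1 ∷ []

  open Endomorphism Poly public using () renaming (Endo to Operator; _^_ to _^ᵒ_)

  -- For exponent 0 the coefficient becomes 0, so `pred 0 = 0` is harmless.
  ∂x ∂y : Operator
  ∂x = map (λ { (mono a i j k) → mono (i · a) (pred i) j k })
  ∂y = map (λ { (mono a i j k) → mono (j · a) i (pred j) k })

  Dx⁻¹ Dy⁻¹ : Operator
  Dx⁻¹ = map (λ { (mono a i j k) → mono (1/suc i * a) (suc i) j k })
  Dy⁻¹ = map (λ { (mono a i j k) → mono (1/suc j * a) i (suc j) k })

  -- The derivatives with respect to D_x⁻¹ and D_y⁻¹, namely ∂ₓ x ∂ₓ and ∂_y y ∂_y:
  -- since D_x⁻ⁿ{1} = xⁿ / n!, they send D_x⁻ⁿ{1} to n D_x⁻⁽ⁿ⁻¹⁾{1}, and similarly for y.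
  ∂/∂Dx⁻¹ ∂/∂Dy⁻¹ : Operator
  ∂/∂Dx⁻¹ p = ∂x (x *ₚ ∂x p)
  ∂/∂Dy⁻¹ p = ∂y (y *ₚ ∂y p)

  degreeBound : Poly → ℕ
  degreeBound = foldr (λ { (mono _ i j k) d → (i ℕ.+ j ℕ.+ k) ℕ.⊔ d }) 0

  -- φ(T) for an operator T that lowers the total degree: T ^ k annihilates p
  -- as soon as k exceeds the degree of p, so the series stops there.
  infixl 8 _⟦_⟧
  _⟦_⟧ : Series → Operator → Operator
  (φ ⟦ T ⟧) p = Polyₛ.Σ≤ (degreeBound p) (λ k → scalar (φ k) *ₚ (T ^ᵒ k) p)

  -- The generating functions live in 𝕂[x,y,z][[t]], and u is f⁻¹(t).

  module _ (r : ℕ) (u : Series) where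

    open RawRing Polyₛ.seriesRing using () renaming (_+_ to _⊕_; _*_ to _⊛_; -_ to ⊖_)
    open RawSemiringDefinitions (RawRing.rawSemiring Polyₛ.seriesRing) using () renaming (_^_ to _^ₛ_)

    private
      ⌈_⌉ : Series → Polyₛ.Series
      ⌈ φ ⌉ n = scalar (φ n)

      X Y Z U : Polyₛ.Series
      X = Polyₛ.constant x
      Y = Polyₛ.constant y
      Z = Polyₛ.constant z
      U = ⌈ u ⌉

      C₀[_] exp[_] : Polyₛ.Series → Polyₛ.Series
      C₀[ g ]  = ⌈ C₀ ⌉ Polyₛ.∘ₛ g
      exp[ g ] = ⌈ expSeries ⌉ Polyₛ.∘ₛ g

    sLeG-gf rLeG-gf : Polyₛ.Series
    sLeG-gf = C₀[ ⊖ (X ⊛ (U ^ₛ 2)) ] ⊛ exp[ (Y ⊛ U) ⊕ (Z ⊛ (U ^ₛ r)) ]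
    rLeG-gf = (C₀[ X ⊛ U ] ⊛ C₀[ ⊖ (Y ⊛ U) ]) ⊛ exp[ Z ⊛ (U ^ₛ r) ]

    sLeG rLeG : ℕ → Poly
    sLeG n = (n !) ·ₚ sLeG-gf n
    rLeG n = (n ! ℕ.* n !) ·ₚ rLeG-gf n

  sLeG-M rLeG-M : ℕ → Operator
  sLeG-M r p = (y *ₚ p) +ₚ (2 ·ₚ Dx⁻¹ (∂y p)) +ₚ (r ·ₚ (z *ₚ (∂y ^ᵒ (r ∸ 1)) p))

  -- Here the coefficient variable y of `sLeG-M` is replaced by D_y⁻¹, so that
  -- the accompanying derivative is ∂/∂Dy⁻¹ = ∂_y y ∂_y. The equation is sometimes
  -- printed with ∂_y itself in its place; that version is false already for
  -- f(t) = t, r = 2, n = 3.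
  rLeG-M r p = (Dy⁻¹ p -ₚ Dx⁻¹ p) +ₚ (r ·ₚ (z *ₚ (∂/∂Dy⁻¹ ^ᵒ (r ∸ 1)) p))

  -- In both equations `1/f′` is the reciprocal series of f′.

  SLeGEquation RLeGEquation : (f 1/f′ : Series) (r n : ℕ) → Poly → Set ℓ₁
  SLeGEquation f 1/f′ r n p =
    (sLeG-M r ((f ⟦ ∂y ⟧) ((1/f′ ⟦ ∂y ⟧) p)) -ₚ (n ·ₚ p)) ≈ₚ 0ₚ
  RLeGEquation f 1/f′ r n p =
    (rLeG-M r ((f ⟦ (λ q → -ₚ ∂/∂Dx⁻¹ q) ⟧) ((1/f′ ⟦ ∂/∂Dy⁻¹ ⟧) p)) -ₚ (n ·ₚ p)) ≈ₚ 0ₚ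

{-# OPTIONS --safe #-}

-- The generating functions have the form G(t) = H(u(t)) with u = f⁻¹ and
-- H(w) = Σ_m h_m w^m, where h_m is a weighted sum of the monomials x^i y^j z^k of
-- degree m, the degree being 2i + j + rk in the first and i + j + rk in the second
-- family. The derivative operators act on H as multiplication by w (h_m ↦ h_{m-1})
-- and the multiplicative operators as d/dw (h_m ↦ (m+1) h_{m+1}). Hence the
-- operator of the equation sends G to (f(u)/f'(u)) H'(u). Since f(u) = t and
-- u' = 1/f'(u), this is t u' H'(u) = t G', whose n-th coefficient is n times that of G.

module Submission where

open import Defs
open import Level using (_⊔_)
open import Algebra.Apartness.Bundles using (HeytingField; HeytingCommutativeRing)
open import Algebra.Bundles using (RawRing; CommutativeRing)
import Algebra.Definitions.RawSemiring as RawSemiringDefinitions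
import Algebra.Properties.CommutativeSemigroup as CommutativeSemigroupProperties
import Algebra.Properties.CommutativeSemiring.Exp as Exp
import Algebra.Properties.Ring as RingProperties
import Algebra.Properties.Semiring.Mult as Mult
import Algebra.Solver.Ring.NaturalCoefficients.Default as NaturalCoefficientsSolver
open import Data.Bool.Base using (true; false; if_then_else_; _∧_)
open import Data.List.Base using ([]; _∷_; _++_; map)
open import Data.Nat.Base as ℕ using (ℕ; zero; suc; pred; _∸_; _≤_; _<_; z≤n; s≤s; _≡ᵇ_; _!)
open import Data.Nat.Properties as ℕₚ using (_≟_)
open import Data.Product.Base using (_×_; _,_; proj₂)
open import Relation.Nullary.Decidable using (⌊_⌋; yes; no; isYes≗does)
open import Relation.Nullary.Negation using (contradiction)
import Relation.Binary.Reasoning.Setoid as ≈-Reasoning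
open import Relation.Binary.PropositionalEquality.Core as ≡ using (_≡_; _≢_)

-- The equation concerns one coefficient of G, so the argument runs on sequences: the n-th
-- polynomial is Σ_m L(m) h_m with L(m) = s [t^n] u^m, where s is the normalising factor. A series φ
-- in a lowering operator turns [t^n] v u^m into [t^n] v φ(u) u^m, so only the multiplier v has to
-- be followed. It ends as t u', and the Euler derivation t d/dt handles this without index shifts
-- or division by t.
--
-- Polynomials are lists of terms that may repeat or have zero coefficients, so operators are
-- controlled only through coefficients. The cut-off in φ(T) depends on the list and must be
-- compared with the cut-off n given by the order of u^m in t; both omit only zeros.
--
-- In the second family -∂ₓ x ∂ₓ and ∂_y y ∂_y lower h_m alike, since the alternating signs of C₀
-- absorb the minus; hence f and 1/f' may take different operators. The coefficients of G are found
-- in iterated power series with t as the innermost variable, where a power of a monomial is one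
-- monomial.

module SeriesProperties {c ℓ} (R : CommutativeRing c ℓ) where

  open CommutativeRing R
  open PowerSeries rawRing
  open ≈-Reasoning setoid
  open CommutativeSemigroupProperties +-commutativeSemigroup using ()
    renaming (interchange to +-medial)
  open CommutativeSemigroupProperties *-commutativeSemigroup using ()
    renaming (x∙yz≈y∙xz to x*yz≈y*xz)
  open Mult semiring using (×-comm-*; ×-assoc-*; ×-congʳ; ×-homo-+)

  -- Finite sums and their rearrangement.

  ·-zeroʳ : ∀ n → n · 0# ≈ 0#
  ·-zeroʳ zero    = refl
  ·-zeroʳ (suc n) = trans (+-identityˡ _) (·-zeroʳ n)

  Σ≤-cong : ∀ n {a b : ℕ → Carrier} → (∀ k → k ≤ n → a k ≈ b k) → Σ≤ n a ≈ Σ≤ n b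
  Σ≤-cong zero    a≈b = +-congʳ (a≈b 0 z≤n)
  Σ≤-cong (suc n) a≈b = +-cong (a≈b 0 z≤n) (Σ≤-cong n (λ k k≤n → a≈b (suc k) (s≤s k≤n)))

  Σ≤-zero : ∀ n {a : ℕ → Carrier} → (∀ k → k ≤ n → a k ≈ 0#) → Σ≤ n a ≈ 0#
  Σ≤-zero zero    a≈0 = trans (+-congʳ (a≈0 0 z≤n)) (+-identityˡ 0#)
  Σ≤-zero (suc n) a≈0 = trans
    (+-cong (a≈0 0 z≤n) (Σ≤-zero n (λ k k≤n → a≈0 (suc k) (s≤s k≤n))))
    (+-identityˡ 0#)

  Σ≤-head : ∀ n (a : ℕ → Carrier) → (∀ k → a (suc k) ≈ 0#) → Σ≤ n a ≈ a 0
  Σ≤-head zero    a _   = +-identityʳ _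
  Σ≤-head (suc n) a a≈0 = trans (+-congˡ (Σ≤-zero n (λ k _ → a≈0 k))) (+-identityʳ _)

  Σ≤-+ : ∀ n (a b : ℕ → Carrier) → Σ≤ n (λ k → a k + b k) ≈ Σ≤ n a + Σ≤ n b
  Σ≤-+ zero    a b = trans (+-congˡ (sym (+-identityˡ 0#))) (+-medial _ _ _ _)
  Σ≤-+ (suc n) a b = trans
    (+-congˡ (Σ≤-+ n (λ k → a (suc k)) (λ k → b (suc k))))
    (+-medial _ _ _ _)

  *-distribˡ-Σ≤ : ∀ n x (a : ℕ → Carrier) → x * Σ≤ n a ≈ Σ≤ n (λ k → x * a k)
  *-distribˡ-Σ≤ zero    x a = trans (distribˡ x _ _) (+-congˡ (zeroʳ x))
  *-distribˡ-Σ≤ (suc n) x a =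
    trans (distribˡ x _ _) (+-congˡ (*-distribˡ-Σ≤ n x (λ k → a (suc k))))

  *-distribʳ-Σ≤ : ∀ n x (a : ℕ → Carrier) → Σ≤ n a * x ≈ Σ≤ n (λ k → a k * x)
  *-distribʳ-Σ≤ zero    x a = trans (distribʳ x _ _) (+-congˡ (zeroˡ x))
  *-distribʳ-Σ≤ (suc n) x a =
    trans (distribʳ x _ _) (+-congˡ (*-distribʳ-Σ≤ n x (λ k → a (suc k))))

  ·-distrib-Σ≤ : ∀ n m (a : ℕ → Carrier) → m · Σ≤ n a ≈ Σ≤ n (λ k → m · a k)
  ·-distrib-Σ≤ n zero    a = sym (Σ≤-zero n (λ _ _ → refl))
  ·-distrib-Σ≤ n (suc m) a =
    trans (+-congˡ (·-distrib-Σ≤ n m a)) (sym (Σ≤-+ n a (λ k → m · a k)))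

  Σ≤-swap : ∀ m n (a : ℕ → ℕ → Carrier) →
            Σ≤ m (λ i → Σ≤ n (a i)) ≈ Σ≤ n (λ j → Σ≤ m (λ i → a i j))
  Σ≤-swap zero    n a =
    trans (+-identityʳ _) (Σ≤-cong n (λ j _ → sym (+-identityʳ (a 0 j))))
  Σ≤-swap (suc m) n a = trans
    (+-congˡ (Σ≤-swap m n (λ i → a (suc i))))
    (sym (Σ≤-+ n (a 0) (λ j → Σ≤ m (λ i → a (suc i) j))))

  Σ≤-last : ∀ n (a : ℕ → Carrier) → Σ≤ (suc n) a ≈ Σ≤ n a + a (suc n)
  Σ≤-last zero    a = trans (sym (+-assoc _ _ _))
    (trans (+-identityʳ _) (+-congʳ (sym (+-identityʳ _))))
  Σ≤-last (suc n) a =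
    trans (+-congˡ (Σ≤-last n (λ k → a (suc k)))) (sym (+-assoc _ _ _))

  Σ≤-reverse : ∀ n (a : ℕ → Carrier) → Σ≤ n (λ k → a (n ∸ k)) ≈ Σ≤ n a
  Σ≤-reverse zero    a = refl
  Σ≤-reverse (suc n) a = begin
    a (suc n) + Σ≤ n (λ k → a (n ∸ k)) ≈⟨ +-congˡ (Σ≤-reverse n a) ⟩
    a (suc n) + Σ≤ n a                 ≈⟨ +-comm _ _ ⟩
    Σ≤ n a + a (suc n)                 ≈⟨ Σ≤-last n a ⟨
    Σ≤ (suc n) a                       ∎

  -- Regroups the triangle i + j ≤ n from diagonals into rows. Removing the row i = 0 from every
  -- diagonal leaves a triangle of the same shape, one size smaller.
  Σ≤-triangle : ∀ n (a : ℕ → ℕ → Carrier) →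
    Σ≤ n (λ k → Σ≤ k (λ i → a i (k ∸ i))) ≈ Σ≤ n (λ i → Σ≤ (n ∸ i) (a i))
  Σ≤-triangle zero    a = refl
  Σ≤-triangle (suc n) a = begin
    (a 0 0 + 0#) + Σ≤ n (λ k → a 0 (suc k) + Σ≤ k (λ i → a (suc i) (k ∸ i)))
      ≈⟨ +-cong (+-identityʳ _) (Σ≤-+ n (λ k → a 0 (suc k)) (λ k → Σ≤ k (λ i → a (suc i) (k ∸ i)))) ⟩
    a 0 0 + (Σ≤ n (λ k → a 0 (suc k)) + Σ≤ n (λ k → Σ≤ k (λ i → a (suc i) (k ∸ i))))
      ≈⟨ +-assoc _ _ _ ⟨
    Σ≤ (suc n) (a 0) + Σ≤ n (λ k → Σ≤ k (λ i → a (suc i) (k ∸ i)))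
      ≈⟨ +-congˡ (Σ≤-triangle n (λ i → a (suc i))) ⟩
    Σ≤ (suc n) (a 0) + Σ≤ n (λ i → Σ≤ (n ∸ i) (a (suc i))) ∎

  Σ≤-extend : ∀ {m n} (a : ℕ → Carrier) → m ≤ n → (∀ k → m < k → a k ≈ 0#) →
              Σ≤ m a ≈ Σ≤ n a
  Σ≤-extend {n = n} a z≤n a≈0 =
    trans (+-identityʳ _) (sym (Σ≤-head n a (λ k → a≈0 (suc k) (s≤s z≤n))))
  Σ≤-extend a (s≤s m≤n) a≈0 =
    +-congˡ (Σ≤-extend (λ k → a (suc k)) m≤n (λ k m<k → a≈0 (suc k) (s≤s m<k)))

  -- Both sums are extended to the maximum. In the application one bound comes from a list of terms
  -- and the other from the power of t, and neither is known to be the larger.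
  Σ≤-bound-irrelevant : ∀ m n (a : ℕ → Carrier) →
    (∀ k → m < k → a k ≈ 0#) → (∀ k → n < k → a k ≈ 0#) → Σ≤ m a ≈ Σ≤ n a
  Σ≤-bound-irrelevant m n a a≈0ₘ a≈0ₙ = trans
    (Σ≤-extend a (ℕₚ.m≤m⊔n m n) a≈0ₘ)
    (sym (Σ≤-extend a (ℕₚ.m≤n⊔m m n) a≈0ₙ))

  -- The commutative ring of formal power series.

  open RawRing seriesRing using () renaming
    (_≈_ to _≈ₛ_; _+_ to _+ₛ_; _*_ to _*ₛ_; 1# to 1ₛ)

  *ₛ-comm : ∀ φ ψ → (φ *ₛ ψ) ≈ₛ (ψ *ₛ φ)
  *ₛ-comm φ ψ n = begin
    Σ≤ n (λ k → φ k * ψ (n ∸ k))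
      ≈⟨ Σ≤-reverse n (λ k → φ k * ψ (n ∸ k)) ⟨
    Σ≤ n (λ k → φ (n ∸ k) * ψ (n ∸ (n ∸ k)))
      ≈⟨ Σ≤-cong n (λ k k≤n → trans (*-comm (φ (n ∸ k)) _) (*-congʳ (reflexive (≡.cong ψ (ℕₚ.m∸[m∸n]≡n k≤n))))) ⟩
    Σ≤ n (λ k → ψ k * φ (n ∸ k)) ∎

  *ₛ-assoc : ∀ φ ψ χ → ((φ *ₛ ψ) *ₛ χ) ≈ₛ (φ *ₛ (ψ *ₛ χ))
  *ₛ-assoc φ ψ χ n = begin
    Σ≤ n (λ k → Σ≤ k (λ i → φ i * ψ (k ∸ i)) * χ (n ∸ k))
      ≈⟨ Σ≤-cong n (λ k _ → begin
           Σ≤ k (λ i → φ i * ψ (k ∸ i)) * χ (n ∸ k)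
             ≈⟨ *-distribʳ-Σ≤ k (χ (n ∸ k)) (λ i → φ i * ψ (k ∸ i)) ⟩
           Σ≤ k (λ i → φ i * ψ (k ∸ i) * χ (n ∸ k))
             ≈⟨ Σ≤-cong k (λ i i≤k → begin
                  φ i * ψ (k ∸ i) * χ (n ∸ k)
                    ≈⟨ *-assoc _ _ _ ⟩
                  φ i * (ψ (k ∸ i) * χ (n ∸ k))
                    -- Writing `k` as `i + (k ∸ i)` makes the summand a function of the pair of
                    -- indices that `Σ≤-triangle` rearranges.
                    ≡⟨ ≡.cong (λ m → φ i * (ψ (k ∸ i) * χ (n ∸ m))) (ℕₚ.m+[n∸m]≡n i≤k) ⟨
                  a i (k ∸ i) ∎) ⟩
           Σ≤ k (λ i → a i (k ∸ i)) ∎) ⟩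
    Σ≤ n (λ k → Σ≤ k (λ i → a i (k ∸ i)))
      ≈⟨ Σ≤-triangle n a ⟩
    Σ≤ n (λ i → Σ≤ (n ∸ i) (a i))
      ≈⟨ Σ≤-cong n (λ i _ → begin
           Σ≤ (n ∸ i) (a i)
             ≈⟨ Σ≤-cong (n ∸ i) (λ j _ → reflexive
                  (≡.cong (λ m → φ i * (ψ j * χ m)) (≡.sym (ℕₚ.∸-+-assoc n i j)))) ⟩
           Σ≤ (n ∸ i) (λ j → φ i * (ψ j * χ (n ∸ i ∸ j)))
             ≈⟨ *-distribˡ-Σ≤ (n ∸ i) (φ i) (λ j → ψ j * χ (n ∸ i ∸ j)) ⟨
           φ i * Σ≤ (n ∸ i) (λ j → ψ j * χ (n ∸ i ∸ j)) ∎) ⟩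
    Σ≤ n (λ i → φ i * Σ≤ (n ∸ i) (λ j → ψ j * χ (n ∸ i ∸ j))) ∎
    where
    a : ℕ → ℕ → Carrier
    a i j = φ i * (ψ j * χ (n ∸ (i ℕ.+ j)))

  *ₛ-identityˡ : ∀ φ → (1ₛ *ₛ φ) ≈ₛ φ
  *ₛ-identityˡ φ n = trans
    (Σ≤-head n (λ k → 1ₛ k * φ (n ∸ k)) (λ k → zeroˡ (φ (n ∸ suc k))))
    (*-identityˡ (φ n))

  *ₛ-distribˡ : ∀ φ ψ χ → (φ *ₛ (ψ +ₛ χ)) ≈ₛ ((φ *ₛ ψ) +ₛ (φ *ₛ χ))
  *ₛ-distribˡ φ ψ χ n = trans
    (Σ≤-cong n (λ k _ → distribˡ (φ k) (ψ (n ∸ k)) (χ (n ∸ k))))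
    (Σ≤-+ n (λ k → φ k * ψ (n ∸ k)) (λ k → φ k * χ (n ∸ k)))

  seriesCommutativeRing : CommutativeRing c ℓ
  seriesCommutativeRing = record
    { RawRing seriesRing
    ; isCommutativeRing = record
      { isRing = record
        { +-isAbelianGroup = record
          { isGroup = record
            { isMonoid = record
              { isSemigroup = record
                { isMagma = record
                  { isEquivalence = record
                    { refl  = λ _ → refl
                    ; sym   = λ e n → sym (e n)
                    ; trans = λ e e′ n → trans (e n) (e′ n)
                    }
                  ; ∙-cong = λ e e′ n → +-cong (e n) (e′ n)
                  }
                ; assoc = λ φ ψ χ n → +-assoc (φ n) (ψ n) (χ n)
                }
              ; identity = (λ φ n → +-identityˡ (φ n)) , (λ φ n → +-identityʳ (φ n))
              }
            ; inverse = (λ φ n → -‿inverseˡ (φ n)) , (λ φ n → -‿inverseʳ (φ n))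
            ; ⁻¹-cong = λ e n → -‿cong (e n)
            }
          ; comm = λ φ ψ n → +-comm (φ n) (ψ n)
          }
        ; *-cong = λ e e′ n → Σ≤-cong n (λ k _ → *-cong (e k) (e′ (n ∸ k)))
        ; *-assoc = *ₛ-assoc
        ; *-identity = *ₛ-identityˡ
                     , (λ φ n → trans (*ₛ-comm φ 1ₛ n) (*ₛ-identityˡ φ n))
        ; distrib = *ₛ-distribˡ , (λ φ ψ χ n → trans (*ₛ-comm (ψ +ₛ χ) φ n)
            (trans (*ₛ-distribˡ φ ψ χ n) (+-cong (*ₛ-comm φ ψ n) (*ₛ-comm φ χ n))))
        }
      ; *-comm = *ₛ-comm
      }
    }

  -- Order of vanishing, composition and the Euler derivation.

  private
    module Sₛ = CommutativeRing seriesCommutativeRing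
    module Mₛ = Mult Sₛ.semiring
  open RawSemiringDefinitions (RawRing.rawSemiring seriesRing) using () renaming (_^_ to _^ₛ_; _×_ to _·ₛ_)
  open Exp Sₛ.commutativeSemiring using (^-homo-*)

  ·ₛ-coefficient : ∀ m φ n → (m ·ₛ φ) n ≡ m · φ n
  ·ₛ-coefficient zero    φ n = ≡.refl
  ·ₛ-coefficient (suc m) φ n = ≡.cong (φ n +_) (·ₛ-coefficient m φ n)

  -- A series without constant term is divisible by t, so its k-th power is divisible by t^k. Every
  -- truncation of a composition rests on this.
  order-^ : ∀ {g} → g 0 ≈ 0# → ∀ k n → n < k → (g ^ₛ k) n ≈ 0#
  order-^ {g} g₀≈0 (suc k) n (s≤s n≤k) = Σ≤-zero n {λ j → g j * (g ^ₛ k) (n ∸ j)} λ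
    { zero    _   → trans (*-congʳ g₀≈0) (zeroˡ _)
    ; (suc j) j<n → trans (*-congˡ (order-^ {g} g₀≈0 k (n ∸ suc j)
        (ℕₚ.<-≤-trans (ℕₚ.∸-monoʳ-< (s≤s z≤n) j<n) n≤k))) (zeroʳ _)
    }

  order-*-^ : ∀ {g} v → g 0 ≈ 0# → ∀ k n → n < k → (v *ₛ (g ^ₛ k)) n ≈ 0#
  order-*-^ {g} v g₀≈0 k n n<k = Σ≤-zero n {λ j → v j * (g ^ₛ k) (n ∸ j)} λ j _ →
    trans (*-congˡ (order-^ {g} g₀≈0 k (n ∸ j) (ℕₚ.≤-<-trans (ℕₚ.m∸n≤m n j) n<k))) (zeroʳ _)

  -- `∘ₛ` truncates each coefficient at its own index, which blocks an exchange of the two sums. The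
  -- order of `g ^ₛ k` allows all inner sums to be extended to the common bound n first.
  *-∘ₛ : ∀ {g} v φ → g 0 ≈ 0# → ∀ n →
         (v *ₛ (φ ∘ₛ g)) n ≈ Σ≤ n (λ k → φ k * (v *ₛ (g ^ₛ k)) n)
  *-∘ₛ {g} v φ g₀≈0 n = begin
    Σ≤ n (λ j → v j * Σ≤ (n ∸ j) (λ k → φ k * (g ^ₛ k) (n ∸ j)))
      ≈⟨ Σ≤-cong n (λ j _ → begin
           v j * Σ≤ (n ∸ j) (λ k → φ k * (g ^ₛ k) (n ∸ j))
             ≈⟨ *-congˡ (Σ≤-extend (λ k → φ k * (g ^ₛ k) (n ∸ j)) (ℕₚ.m∸n≤m n j)
                  (λ k lt → trans (*-congˡ (order-^ {g} g₀≈0 k (n ∸ j) lt)) (zeroʳ (φ k)))) ⟩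
           v j * Σ≤ n (λ k → φ k * (g ^ₛ k) (n ∸ j))
             ≈⟨ *-distribˡ-Σ≤ n (v j) (λ k → φ k * (g ^ₛ k) (n ∸ j)) ⟩
           Σ≤ n (λ k → v j * (φ k * (g ^ₛ k) (n ∸ j)))
             ≈⟨ Σ≤-cong n (λ k _ → x*yz≈y*xz (v j) (φ k) ((g ^ₛ k) (n ∸ j))) ⟩
           Σ≤ n (λ k → φ k * (v j * (g ^ₛ k) (n ∸ j))) ∎) ⟩
    Σ≤ n (λ j → Σ≤ n (λ k → φ k * (v j * (g ^ₛ k) (n ∸ j))))
      ≈⟨ Σ≤-swap n n (λ j k → φ k * (v j * (g ^ₛ k) (n ∸ j))) ⟩
    Σ≤ n (λ k → Σ≤ n (λ j → φ k * (v j * (g ^ₛ k) (n ∸ j))))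
      ≈⟨ Σ≤-cong n (λ k _ → *-distribˡ-Σ≤ n (φ k) (λ j → v j * (g ^ₛ k) (n ∸ j))) ⟨
    Σ≤ n (λ k → φ k * (v *ₛ (g ^ₛ k)) n) ∎

  ∘ₛ-cong : ∀ {φ ψ g} → φ ≈ₛ ψ → (φ ∘ₛ g) ≈ₛ (ψ ∘ₛ g)
  ∘ₛ-cong {g = g} φ≈ψ n = Σ≤-cong n (λ k _ → *-congʳ {(g ^ₛ k) n} (φ≈ψ k))

  1-∘ₛ : ∀ g → (1ₛ ∘ₛ g) ≈ₛ 1ₛ
  1-∘ₛ g n = trans
    (Σ≤-head n (λ k → 1ₛ k * (g ^ₛ k) n) (λ k → zeroˡ ((g ^ₛ suc k) n)))
    (*-identityˡ (1ₛ n))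

  -- The terms φ_i ψ_j g^(i+j) range over the triangle i + j ≤ n. Off the triangle g^(i+j) has order
  -- above n, so the sum may run over the whole square, where it factors by two uses of `*-∘ₛ`.
  *-homo-∘ₛ : ∀ {g} φ ψ → g 0 ≈ 0# → ((φ *ₛ ψ) ∘ₛ g) ≈ₛ ((φ ∘ₛ g) *ₛ (ψ ∘ₛ g))
  *-homo-∘ₛ {g} φ ψ g₀≈0 n = begin
    Σ≤ n (λ k → Σ≤ k (λ i → φ i * ψ (k ∸ i)) * (g ^ₛ k) n)
      ≈⟨ Σ≤-cong n (λ k _ → begin
           Σ≤ k (λ i → φ i * ψ (k ∸ i)) * (g ^ₛ k) n
             ≈⟨ *-distribʳ-Σ≤ k ((g ^ₛ k) n) (λ i → φ i * ψ (k ∸ i)) ⟩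
           Σ≤ k (λ i → φ i * ψ (k ∸ i) * (g ^ₛ k) n)
             ≈⟨ Σ≤-cong k (λ i i≤k → reflexive
                  (≡.cong (λ m → φ i * ψ (k ∸ i) * (g ^ₛ m) n) (≡.sym (ℕₚ.m+[n∸m]≡n i≤k)))) ⟩
           Σ≤ k (λ i → a i (k ∸ i)) ∎) ⟩
    Σ≤ n (λ k → Σ≤ k (λ i → a i (k ∸ i)))
      ≈⟨ Σ≤-triangle n a ⟩
    Σ≤ n (λ i → Σ≤ (n ∸ i) (a i))
      ≈⟨ Σ≤-cong n (λ i i≤n → Σ≤-extend (a i) (ℕₚ.m∸n≤m n i) (λ j lt →
           trans (*-congˡ (order-^ {g} g₀≈0 (i ℕ.+ j) n
             (ℕₚ.≤-<-trans (ℕₚ.≤-reflexive (≡.sym (ℕₚ.m+[n∸m]≡n i≤n))) (ℕₚ.+-monoʳ-< i lt))))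
             (zeroʳ _))) ⟩
    Σ≤ n (λ i → Σ≤ n (a i))
      ≈⟨ Σ≤-swap n n a ⟩
    Σ≤ n (λ j → Σ≤ n (λ i → a i j))
      ≈⟨ Σ≤-cong n (λ j _ → begin
           Σ≤ n (λ i → a i j)
             ≈⟨ Σ≤-cong n (λ i _ → begin
                  φ i * ψ j * (g ^ₛ (i ℕ.+ j)) n
                    ≈⟨ *-cong (*-comm _ _) (trans (^-homo-* g i j n) (*ₛ-comm (g ^ₛ i) (g ^ₛ j) n)) ⟩
                  ψ j * φ i * ((g ^ₛ j) *ₛ (g ^ₛ i)) n
                    ≈⟨ *-assoc _ _ _ ⟩
                  ψ j * (φ i * ((g ^ₛ j) *ₛ (g ^ₛ i)) n) ∎) ⟩
           Σ≤ n (λ i → ψ j * (φ i * ((g ^ₛ j) *ₛ (g ^ₛ i)) n))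
             ≈⟨ *-distribˡ-Σ≤ n (ψ j) (λ i → φ i * ((g ^ₛ j) *ₛ (g ^ₛ i)) n) ⟨
           ψ j * Σ≤ n (λ i → φ i * ((g ^ₛ j) *ₛ (g ^ₛ i)) n)
             ≈⟨ *-congˡ (*-∘ₛ {g} (g ^ₛ j) φ g₀≈0 n) ⟨
           ψ j * ((g ^ₛ j) *ₛ (φ ∘ₛ g)) n
             ≈⟨ *-congˡ (*ₛ-comm (g ^ₛ j) (φ ∘ₛ g) n) ⟩
           ψ j * ((φ ∘ₛ g) *ₛ (g ^ₛ j)) n ∎) ⟩
    Σ≤ n (λ j → ψ j * ((φ ∘ₛ g) *ₛ (g ^ₛ j)) n)
      ≈⟨ *-∘ₛ {g} (φ ∘ₛ g) ψ g₀≈0 n ⟨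
    ((φ ∘ₛ g) *ₛ (ψ ∘ₛ g)) n ∎
    where
    a : ℕ → ℕ → Carrier
    a i j = (φ i * ψ j) * (g ^ₛ (i ℕ.+ j)) n

  -- The Euler derivation t d/dt: unlike d/dt it does not shift coefficients.
  θ : Series → Series
  θ φ n = n · φ n

  θ-leibniz : ∀ φ ψ → θ (φ *ₛ ψ) ≈ₛ ((θ φ *ₛ ψ) +ₛ (φ *ₛ θ ψ))
  θ-leibniz φ ψ n = begin
    n · Σ≤ n (λ k → φ k * ψ (n ∸ k))
      ≈⟨ ·-distrib-Σ≤ n n (λ k → φ k * ψ (n ∸ k)) ⟩
    Σ≤ n (λ k → n · (φ k * ψ (n ∸ k)))
      ≈⟨ Σ≤-cong n (λ k k≤n → begin
           n · (φ k * ψ (n ∸ k))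
             ≡⟨ ≡.cong (_· (φ k * ψ (n ∸ k))) (ℕₚ.m+[n∸m]≡n k≤n) ⟨
           (k ℕ.+ (n ∸ k)) · (φ k * ψ (n ∸ k))
             ≈⟨ ×-homo-+ (φ k * ψ (n ∸ k)) k (n ∸ k) ⟩
           k · (φ k * ψ (n ∸ k)) + (n ∸ k) · (φ k * ψ (n ∸ k))
             ≈⟨ +-cong (×-assoc-* k _ _) (×-comm-* (n ∸ k) _ _) ⟨
           θ φ k * ψ (n ∸ k) + φ k * θ ψ (n ∸ k) ∎) ⟩
    Σ≤ n (λ k → θ φ k * ψ (n ∸ k) + φ k * θ ψ (n ∸ k))
      ≈⟨ Σ≤-+ n (λ k → θ φ k * ψ (n ∸ k)) (λ k → φ k * θ ψ (n ∸ k)) ⟩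
    Σ≤ n (λ k → θ φ k * ψ (n ∸ k)) + Σ≤ n (λ k → φ k * θ ψ (n ∸ k)) ∎

  θ-1 : θ 1ₛ ≈ₛ (λ _ → 0#)
  θ-1 zero    = refl
  θ-1 (suc n) = ·-zeroʳ (suc n)

  -- The usual power rule; for m = 0 the factor m erases the term containing `pred m`.
  θ-^ : ∀ g m → θ (g ^ₛ m) ≈ₛ (m ·ₛ (θ g *ₛ (g ^ₛ pred m)))
  θ-^ g zero    = θ-1
  θ-^ g (suc m) = Sₛ.trans (θ-leibniz g (g ^ₛ m)) (Sₛ.+-congˡ {θ g *ₛ (g ^ₛ m)}
    (Sₛ.trans (Sₛ.*-congˡ {g} (θ-^ g m)) (rest m)))
    where
    rest : ∀ m → (g *ₛ (m ·ₛ (θ g *ₛ (g ^ₛ pred m)))) ≈ₛ (m ·ₛ (θ g *ₛ (g ^ₛ m)))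
    rest zero    = Sₛ.zeroʳ g
    rest (suc m) = Sₛ.trans (Mₛ.×-comm-* (suc m) g (θ g *ₛ (g ^ₛ m)))
      (Mₛ.×-congʳ (suc m) (CommutativeSemigroupProperties.x∙yz≈y∙xz Sₛ.*-commutativeSemigroup g (θ g) (g ^ₛ m)))

  θ-∘ₛ : ∀ {g} φ → g 0 ≈ 0# → θ (φ ∘ₛ g) ≈ₛ (θ g *ₛ (derivative φ ∘ₛ g))
  θ-∘ₛ {g} φ g₀≈0 n = begin
    n · Σ≤ n (λ k → φ k * (g ^ₛ k) n)
      -- The added term k = n + 1 is zero because its power of g has order above n. Once the term k
      -- = 0 drops out, the shifted sum again has the bound n that the composition with
      -- `derivative φ` requires.
      ≈⟨ ×-congʳ n (Σ≤-extend (λ k → φ k * (g ^ₛ k) n) (ℕₚ.n≤1+n n) (λ k n<k →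
           trans (*-congˡ (order-^ {g} g₀≈0 k n n<k)) (zeroʳ (φ k)))) ⟩
    n · Σ≤ (suc n) (λ k → φ k * (g ^ₛ k) n)
      ≈⟨ ·-distrib-Σ≤ (suc n) n (λ k → φ k * (g ^ₛ k) n) ⟩
    Σ≤ (suc n) (λ k → n · (φ k * (g ^ₛ k) n))
      ≈⟨ Σ≤-cong (suc n) (λ k _ → begin
           n · (φ k * (g ^ₛ k) n)
             ≈⟨ ×-comm-* n (φ k) ((g ^ₛ k) n) ⟨
           φ k * θ (g ^ₛ k) n
             ≈⟨ *-congˡ (θ-^ g k n) ⟩
           φ k * (k ·ₛ (θ g *ₛ (g ^ₛ pred k))) n
             ≡⟨ ≡.cong (φ k *_) (·ₛ-coefficient k (θ g *ₛ (g ^ₛ pred k)) n) ⟩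
           φ k * (k · (θ g *ₛ (g ^ₛ pred k)) n) ∎) ⟩
    φ 0 * 0# + Σ≤ n (λ k → φ (suc k) * (suc k · (θ g *ₛ (g ^ₛ k)) n))
      ≈⟨ trans (+-congʳ (zeroʳ _)) (+-identityˡ _) ⟩
    Σ≤ n (λ k → φ (suc k) * (suc k · (θ g *ₛ (g ^ₛ k)) n))
      ≈⟨ Σ≤-cong n (λ k _ → begin
           φ (suc k) * (suc k · (θ g *ₛ (g ^ₛ k)) n)
             ≈⟨ ×-comm-* (suc k) (φ (suc k)) ((θ g *ₛ (g ^ₛ k)) n) ⟩
           suc k · (φ (suc k) * (θ g *ₛ (g ^ₛ k)) n)
             ≈⟨ ×-assoc-* (suc k) (φ (suc k)) ((θ g *ₛ (g ^ₛ k)) n) ⟨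
           derivative φ k * (θ g *ₛ (g ^ₛ k)) n ∎) ⟩
    Σ≤ n (λ k → derivative φ k * (θ g *ₛ (g ^ₛ k)) n)
      ≈⟨ *-∘ₛ {g} (θ g) (derivative φ) g₀≈0 n ⟨
    (θ g *ₛ (derivative φ ∘ₛ g)) n ∎

  θ-t : θ t ≈ₛ t
  θ-t zero          = refl
  θ-t (suc zero)    = +-identityʳ 1#
  θ-t (suc (suc n)) = ·-zeroʳ (suc (suc n))

-- The Euler derivative of a compositional inverse.

module _ {c ℓ} (R : CommutativeRing c ℓ) where

  open SeriesProperties R
  open PowerSeries (CommutativeRing.rawRing R)
  open CommutativeRing seriesCommutativeRing using () renaming
    (_≈_ to _≈ₛ_; _*_ to _*ₛ_; 1# to 1ₛ)
  open CommutativeSemigroupProperties (CommutativeRing.*-commutativeSemigroup seriesCommutativeRing)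
    using (x∙yz≈y∙zx)
  private
    module Sₛ = CommutativeRing seriesCommutativeRing
  open Mult (CommutativeRing.semiring R) using (×-congʳ)
  open ≈-Reasoning Sₛ.setoid

  -- The chain rule applied to f(g) = t reads t = θ g · f'(g). Multiplying by (1/f')(g) cancels
  -- f'(g), because composition with g is multiplicative and sends 1 to 1.
  θ-inverse : ∀ {f g 1/f′} → CommutativeRing._≈_ R (g 0) (CommutativeRing.0# R) → (f ∘ₛ g) ≈ₛ t → (derivative f *ₛ 1/f′) ≈ₛ 1ₛ →
              θ g ≈ₛ ((1/f′ ∘ₛ g) *ₛ (f ∘ₛ g))
  θ-inverse {f} {g} {1/f′} g₀≈0 fg≈t f′/f′≈1 = Sₛ.sym (begin
    (1/f′ ∘ₛ g) *ₛ (f ∘ₛ g)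
      ≈⟨ Sₛ.*-congˡ {1/f′ ∘ₛ g} fg≈t ⟩
    (1/f′ ∘ₛ g) *ₛ t
      ≈⟨ Sₛ.*-congˡ {1/f′ ∘ₛ g} (Sₛ.trans (Sₛ.sym θ-t) (Sₛ.trans (λ n → ×-congʳ n (CommutativeRing.sym R (fg≈t n))) (θ-∘ₛ f g₀≈0))) ⟩
    (1/f′ ∘ₛ g) *ₛ (θ g *ₛ (derivative f ∘ₛ g))
      ≈⟨ x∙yz≈y∙zx (1/f′ ∘ₛ g) (θ g) (derivative f ∘ₛ g) ⟩
    θ g *ₛ ((derivative f ∘ₛ g) *ₛ (1/f′ ∘ₛ g))
      ≈⟨ Sₛ.*-congˡ {θ g} (Sₛ.trans (Sₛ.sym (*-homo-∘ₛ (derivative f) 1/f′ g₀≈0))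
            (Sₛ.trans (∘ₛ-cong f′/f′≈1) (1-∘ₛ g))) ⟩
    θ g *ₛ 1ₛ
      ≈⟨ Sₛ.*-identityʳ (θ g) ⟩
    θ g ∎)

-- Coefficients of polynomials and of their images under the operators.

module PolynomialCoefficients {c ℓ₁ ℓ₂} (K : HeytingField c ℓ₁ ℓ₂) (char0 : CharacteristicZero K) where

  𝔽 : CommutativeRing c ℓ₁
  𝔽 = HeytingCommutativeRing.commutativeRing (HeytingField.heytingCommutativeRing K)

  open LegendreGouldHopperSheffer K char0
  open CommutativeRing 𝔽 hiding (zero)
  open HeytingField K using (#⇒invertible)
  open 𝕂ₛ using (_·_; Σ≤)
  open ≈-Reasoning setoid
  open Mult semiring using (×-assoc-*; ×-congʳ)
  open RingProperties ring using (-0#≈0#; -1*x≈-x)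

  ι : ℕ → 𝕂
  ι n = n · 1#

  ·≈ι* : ∀ n a → n · a ≈ ι n * a
  ·≈ι* n a = sym (trans (×-assoc-* n 1# a) (×-congʳ n (*-identityˡ a)))

  ι-*-1/suc : ∀ n → ι (suc n) * 1/suc n ≈ 1#
  -- Apartness from `0#` yields an inverse of the difference `ι (suc n) - 0#`, hence the removal of
  -- `- 0#`.
  ι-*-1/suc n = trans (*-congʳ (sym (trans (+-congˡ -0#≈0#) (+-identityʳ _))))
    (proj₂ (proj₂ (#⇒invertible (char0 n))))

  -- A Kronecker delta carrying a value. The boolean test makes `δ (suc m) (suc n) a` reduce to
  -- `δ m n a`, so multiplication by a variable shifts exponents by computation alone.
  δ : ℕ → ℕ → 𝕂 → 𝕂
  δ m n a = if m ≡ᵇ n then a else 0#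

  δ-cong : ∀ m n {a b} → a ≈ b → δ m n a ≈ δ m n b
  δ-cong m n a≈b with m ≡ᵇ n
  ... | true  = a≈b
  ... | false = refl

  δ-zero : ∀ m n → δ m n 0# ≈ 0#
  δ-zero m n with m ≡ᵇ n
  ... | true  = refl
  ... | false = refl

  *-δ : ∀ m n x a → δ m n (x * a) ≈ x * δ m n a
  *-δ m n x a with m ≡ᵇ n
  ... | true  = refl
  ... | false = sym (zeroʳ x)

  *-δ³ : ∀ i i′ j j′ k k′ x a →
         δ i i′ (δ j j′ (δ k k′ (x * a))) ≈ x * δ i i′ (δ j j′ (δ k k′ a))
  *-δ³ i i′ j j′ k k′ x a = trans
    (δ-cong i i′ (trans (δ-cong j j′ (*-δ k k′ x a)) (*-δ j j′ x _)))
    (*-δ i i′ x _)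

  δ-≢ : ∀ {m n} a → m ≢ n → δ m n a ≈ 0#
  δ-≢ {zero}  {zero}  a m≢n = contradiction ≡.refl m≢n
  δ-≢ {zero}  {suc n} a m≢n = refl
  δ-≢ {suc m} {zero}  a m≢n = refl
  δ-≢ {suc m} {suc n} a m≢n = δ-≢ {m} {n} a (λ m≡n → m≢n (≡.cong suc m≡n))

  -- A derivative multiplies each term by a factor depending on that term's own exponent. Under the
  -- delta this exponent may be replaced by the target exponent, so the factor becomes common to all
  -- terms and leaves the sum.
  δ-subst : ∀ m n (f : ℕ → 𝕂) → δ m n (f m) ≈ δ m n (f n)
  δ-subst m n f with m ≟ n
  ... | yes ≡.refl = refl
  ... | no  m≢n    = trans (δ-≢ (f m) m≢n) (sym (δ-≢ (f n) m≢n))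

  δ-derivative : ∀ m n a → δ (pred m) n (ι m * a) ≈ ι (suc n) * δ m (suc n) a
  δ-derivative zero    n a =
    trans (δ-cong 0 n (zeroˡ a)) (trans (δ-zero 0 n) (sym (zeroʳ _)))
  δ-derivative (suc m) n a = trans
    (δ-subst m n (λ l → ι (suc l) * a))
    (*-δ m n (ι (suc n)) a)

  δ-antiderivative : ∀ m n a → δ (suc m) (suc n) (1/suc m * a) ≈ 1/suc n * δ m n a
  δ-antiderivative m n a =
    trans (δ-subst m n (λ l → 1/suc l * a)) (*-δ m n (1/suc n) a)

  termCoeff : Term → ℕ → ℕ → ℕ → 𝕂
  termCoeff (mono a i j k) i′ j′ k′ = δ i i′ (δ j j′ (δ k k′ a))

  -- Replaces the conjunction of decisions in `coeff` by nested deltas, which compute on successors;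
  -- `does (i ≟ i′)` is `i ≡ᵇ i′` by definition.
  coeff-∷ : ∀ τ p i j k → coeff (τ ∷ p) i j k ≈ termCoeff τ i j k + coeff p i j k
  coeff-∷ (mono a i j k) p i′ j′ k′ =
    +-congʳ (reflexive same)
    where
    if-∧ : ∀ b b′ b″ → (if b ∧ b′ ∧ b″ then a else 0#) ≡
           (if b then (if b′ then (if b″ then a else 0#) else 0#) else 0#)
    if-∧ false b′    b″ = ≡.refl
    if-∧ true  false b″ = ≡.refl
    if-∧ true  true  b″ = ≡.refl

    same : (if ⌊ i ≟ i′ ⌋ ∧ ⌊ j ≟ j′ ⌋ ∧ ⌊ k ≟ k′ ⌋ then a else 0#) ≡ δ i i′ (δ j j′ (δ k k′ a))
    same rewrite isYes≗does (i ≟ i′) | isYes≗does (j ≟ j′) | isYes≗does (k ≟ k′) =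
      if-∧ (i ≡ᵇ i′) (j ≡ᵇ j′) (k ≡ᵇ k′)

  coeff-++ : ∀ p q i j k → coeff (p ++ q) i j k ≈ coeff p i j k + coeff q i j k
  coeff-++ []      q i j k = sym (+-identityˡ _)
  coeff-++ (_ ∷ p) q i j k = trans (+-congˡ (coeff-++ p q i j k)) (sym (+-assoc _ _ _))

  coeff-++[] : ∀ p i j k → coeff (p ++ []) i j k ≈ coeff p i j k
  coeff-++[] p i j k = trans (coeff-++ p [] i j k) (+-identityʳ _)

  -- Derivatives, their inverses, negation and multiplication by one monomial all act term by term,
  -- so a check on a single term suffices as long as κ depends only on the target exponents.
  coeff-map : ∀ (F : Term → Term) κ i j k i′ j′ k′ →
    (∀ τ → termCoeff (F τ) i j k ≈ κ * termCoeff τ i′ j′ k′) →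
    ∀ p → coeff (map F p) i j k ≈ κ * coeff p i′ j′ k′
  coeff-map F κ i j k i′ j′ k′ e []      = sym (zeroʳ κ)
  coeff-map F κ i j k i′ j′ k′ e (τ ∷ p) = begin
    coeff (F τ ∷ map F p) i j k
      ≈⟨ coeff-∷ (F τ) (map F p) i j k ⟩
    termCoeff (F τ) i j k + coeff (map F p) i j k
      ≈⟨ +-cong (e τ) (coeff-map F κ i j k i′ j′ k′ e p) ⟩
    κ * termCoeff τ i′ j′ k′ + κ * coeff p i′ j′ k′
      ≈⟨ distribˡ _ _ _ ⟨
    κ * (termCoeff τ i′ j′ k′ + coeff p i′ j′ k′)
      ≈⟨ *-congˡ (coeff-∷ τ p i′ j′ k′) ⟨
    κ * coeff (τ ∷ p) i′ j′ k′ ∎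

  coeff-map-zero : ∀ (F : Term → Term) i j k → (∀ τ → termCoeff (F τ) i j k ≈ 0#) →
    ∀ p → coeff (map F p) i j k ≈ 0#
  coeff-map-zero F i j k e p = trans
    (coeff-map F 0# i j k i j k (λ τ → trans (e τ) (sym (zeroˡ _))) p) (zeroˡ _)

  coeff-negate : ∀ p i j k → coeff (-ₚ p) i j k ≈ - coeff p i j k
  coeff-negate p i j k = trans
    (coeff-map _ (- 1#) i j k i j k (λ { (mono a i′ j′ k′) → trans
      (δ-cong i′ i (δ-cong j′ j (δ-cong k′ k (sym (-1*x≈-x a)))))
      (*-δ³ i′ i j′ j k′ k (- 1#) a) }) p)
    (-1*x≈-x _)

  coeff-·ₚ : ∀ n p i j k → coeff (n ·ₚ p) i j k ≈ n · coeff p i j k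
  coeff-·ₚ zero    p i j k = refl
  coeff-·ₚ (suc n) p i j k = trans (coeff-++ p (n ·ₚ p) i j k) (+-congˡ (coeff-·ₚ n p i j k))

  coeff-Σ≤ : ∀ n (a : ℕ → Poly) i j k →
             coeff (Polyₛ.Σ≤ n a) i j k ≈ Σ≤ n (λ l → coeff (a l) i j k)
  coeff-Σ≤ zero    a i j k = coeff-++ (a 0) [] i j k
  coeff-Σ≤ (suc n) a i j k = trans
    (coeff-++ (a 0) (Polyₛ.Σ≤ n (λ l → a (suc l))) i j k)
    (+-congˡ (coeff-Σ≤ n (λ l → a (suc l)) i j k))

  coeff-scalar-* : ∀ a p i j k → coeff (scalar a *ₚ p) i j k ≈ a * coeff p i j k
  coeff-scalar-* a p i j k = trans (coeff-++[] (map (mono a 0 0 0 *ₜ_) p) i j k)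
    (coeff-map _ a i j k i j k (λ { (mono b i′ j′ k′) → *-δ³ i′ i j′ j k′ k a b }) p)

  coeff-x*-suc : ∀ p i j k → coeff (x *ₚ p) (suc i) j k ≈ coeff p i j k
  coeff-x*-suc p i j k = trans (coeff-++[] (map (mono 1# 1 0 0 *ₜ_) p) (suc i) j k) (trans
    (coeff-map _ 1# (suc i) j k i j k (λ { (mono a i′ j′ k′) → *-δ³ i′ i j′ j k′ k 1# a }) p)
    (*-identityˡ _))

  coeff-y*-zero : ∀ p i k → coeff (y *ₚ p) i 0 k ≈ 0#
  coeff-y*-zero p i k = trans (coeff-++[] (map (mono 1# 0 1 0 *ₜ_) p) i 0 k)
    (coeff-map-zero _ i 0 k (λ { (mono _ i′ _ _) → δ-zero i′ i }) p)

  coeff-y*-suc : ∀ p i j k → coeff (y *ₚ p) i (suc j) k ≈ coeff p i j k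
  coeff-y*-suc p i j k = trans (coeff-++[] (map (mono 1# 0 1 0 *ₜ_) p) i (suc j) k) (trans
    (coeff-map _ 1# i (suc j) k i j k (λ { (mono a i′ j′ k′) → *-δ³ i′ i j′ j k′ k 1# a }) p)
    (*-identityˡ _))

  coeff-z*-zero : ∀ p i j → coeff (z *ₚ p) i j 0 ≈ 0#
  coeff-z*-zero p i j = trans (coeff-++[] (map (mono 1# 0 0 1 *ₜ_) p) i j 0)
    (coeff-map-zero _ i j 0
      (λ { (mono _ i′ j′ _) → trans (δ-cong i′ i (δ-zero j′ j)) (δ-zero i′ i) }) p)

  coeff-z*-suc : ∀ p i j k → coeff (z *ₚ p) i j (suc k) ≈ coeff p i j k
  coeff-z*-suc p i j k = trans (coeff-++[] (map (mono 1# 0 0 1 *ₜ_) p) i j (suc k)) (trans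
    (coeff-map _ 1# i j (suc k) i j k (λ { (mono a i′ j′ k′) → *-δ³ i′ i j′ j k′ k 1# a }) p)
    (*-identityˡ _))

  coeff-∂x : ∀ p i j k → coeff (∂x p) i j k ≈ ι (suc i) * coeff p (suc i) j k
  coeff-∂x p i j k = coeff-map _ (ι (suc i)) i j k (suc i) j k (λ { (mono a i′ j′ k′) → trans
    (δ-cong (pred i′) i (trans
      (δ-cong j′ j (trans (δ-cong k′ k (·≈ι* i′ a)) (*-δ k′ k (ι i′) a)))
      (*-δ j′ j (ι i′) _)))
    (δ-derivative i′ i _) }) p

  coeff-∂y : ∀ p i j k → coeff (∂y p) i j k ≈ ι (suc j) * coeff p i (suc j) k
  coeff-∂y p i j k = coeff-map _ (ι (suc j)) i j k i (suc j) k (λ { (mono a i′ j′ k′) → trans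
    (δ-cong i′ i (trans
      (δ-cong (pred j′) j (trans (δ-cong k′ k (·≈ι* j′ a)) (*-δ k′ k (ι j′) a)))
      (δ-derivative j′ j _)))
    (*-δ i′ i _ _) }) p

  coeff-Dx⁻¹-zero : ∀ p j k → coeff (Dx⁻¹ p) 0 j k ≈ 0#
  coeff-Dx⁻¹-zero p j k = coeff-map-zero _ 0 j k (λ { (mono _ _ _ _) → refl }) p

  coeff-Dx⁻¹-suc : ∀ p i j k → coeff (Dx⁻¹ p) (suc i) j k ≈ 1/suc i * coeff p i j k
  coeff-Dx⁻¹-suc p i j k = coeff-map _ (1/suc i) (suc i) j k i j k (λ { (mono a i′ j′ k′) → trans
    (δ-cong i′ i (trans (δ-cong j′ j (*-δ k′ k (1/suc i′) a)) (*-δ j′ j (1/suc i′) _)))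
    (δ-antiderivative i′ i _) }) p

  coeff-Dy⁻¹-zero : ∀ p i k → coeff (Dy⁻¹ p) i 0 k ≈ 0#
  coeff-Dy⁻¹-zero p i k = coeff-map-zero _ i 0 k (λ { (mono _ i′ _ _) → δ-zero i′ i }) p

  coeff-Dy⁻¹-suc : ∀ p i j k → coeff (Dy⁻¹ p) i (suc j) k ≈ 1/suc j * coeff p i j k
  coeff-Dy⁻¹-suc p i j k = coeff-map _ (1/suc j) i (suc j) k i j k (λ { (mono a i′ j′ k′) → trans
    (δ-cong i′ i (trans (δ-cong j′ j (*-δ k′ k (1/suc j′) a)) (δ-antiderivative j′ j _)))
    (*-δ i′ i _ _) }) p

  coeff-∂/∂Dx⁻¹ : ∀ p i j k →
    coeff (∂/∂Dx⁻¹ p) i j k ≈ ι (suc i) * (ι (suc i) * coeff p (suc i) j k)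
  coeff-∂/∂Dx⁻¹ p i j k = trans (coeff-∂x (x *ₚ ∂x p) i j k)
    (*-congˡ (trans (coeff-x*-suc (∂x p) i j k) (coeff-∂x p i j k)))

  coeff-∂/∂Dy⁻¹ : ∀ p i j k →
    coeff (∂/∂Dy⁻¹ p) i j k ≈ ι (suc j) * (ι (suc j) * coeff p i (suc j) k)
  coeff-∂/∂Dy⁻¹ p i j k = trans (coeff-∂y (y *ₚ ∂y p) i j k)
    (*-congˡ (trans (coeff-y*-suc (∂y p) i j k) (coeff-∂y p i j k)))

  -- A degree bound on coefficients instead of on the list: `∂y` turns a term without y into a term
  -- with coefficient zero and the same exponents, so `degreeBound` need not drop.
  VanishesFrom : ℕ → Poly → Set ℓ₁
  VanishesFrom d p = ∀ i j k → d ≤ i ℕ.+ j ℕ.+ k → coeff p i j k ≈ 0#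

  LowersDegree : Operator → Set _
  LowersDegree T = ∀ d p → VanishesFrom (suc d) p → VanishesFrom d (T p)

  vanishes-beyond-degreeBound : ∀ p → VanishesFrom (suc (degreeBound p)) p
  vanishes-beyond-degreeBound []                   i j k _  = refl
  vanishes-beyond-degreeBound (mono a i′ j′ k′ ∷ p) i j k lt = trans
    (coeff-∷ (mono a i′ j′ k′) p i j k)
    (trans (+-cong head≈0 (vanishes-beyond-degreeBound p i j k
      (ℕₚ.≤-trans (s≤s (ℕₚ.m≤n⊔m (i′ ℕ.+ j′ ℕ.+ k′) _)) lt))) (+-identityˡ 0#))
    where
    head≈0 : termCoeff (mono a i′ j′ k′) i j k ≈ 0#
    head≈0 with i′ ≟ i | j′ ≟ j | k′ ≟ k
    ... | no i′≢i    | _          | _          = δ-≢ _ i′≢i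
    ... | yes _      | no j′≢j    | _          = trans (δ-cong i′ i (δ-≢ _ j′≢j)) (δ-zero i′ i)
    ... | yes _      | yes _      | no k′≢k    =
      trans (δ-cong i′ i (trans (δ-cong j′ j (δ-≢ _ k′≢k)) (δ-zero j′ j))) (δ-zero i′ i)
    ... | yes ≡.refl | yes ≡.refl | yes ≡.refl =
      contradiction (ℕₚ.m≤m⊔n (i ℕ.+ j ℕ.+ k) _) (ℕₚ.<⇒≱ lt)

  power-vanishes : ∀ {T} → LowersDegree T → ∀ k d p →
                   VanishesFrom (k ℕ.+ d) p → VanishesFrom d ((T ^ᵒ k) p)
  power-vanishes         lowers zero    d p v = v
  power-vanishes {T = T} lowers (suc k) d p v = lowers d ((T ^ᵒ k) p)
    (power-vanishes lowers k (suc d) p (≡.subst (λ m → VanishesFrom m p) (≡.sym (ℕₚ.+-suc k d)) v))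

  ∂y-lowersDegree : LowersDegree ∂y
  ∂y-lowersDegree d p v i j k le = trans (coeff-∂y p i j k) (trans (*-congˡ (v i (suc j) k
    (≡.subst (λ m → suc d ≤ m ℕ.+ k) (≡.sym (ℕₚ.+-suc i j)) (s≤s le)))) (zeroʳ _))

  ∂/∂Dy⁻¹-lowersDegree : LowersDegree ∂/∂Dy⁻¹
  ∂/∂Dy⁻¹-lowersDegree d p v i j k le = trans (coeff-∂/∂Dy⁻¹ p i j k)
    (trans (*-congˡ (trans (*-congˡ (v i (suc j) k
      (≡.subst (λ m → suc d ≤ m ℕ.+ k) (≡.sym (ℕₚ.+-suc i j)) (s≤s le)))) (zeroʳ _))) (zeroʳ _))

  -∂/∂Dx⁻¹-lowersDegree : LowersDegree (λ q → -ₚ ∂/∂Dx⁻¹ q)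
  -∂/∂Dx⁻¹-lowersDegree d p v i j k le = trans (coeff-negate (∂/∂Dx⁻¹ p) i j k)
    (trans (-‿cong (trans (coeff-∂/∂Dx⁻¹ p i j k)
      (trans (*-congˡ (trans (*-congˡ (v (suc i) j k (s≤s le))) (zeroʳ _))) (zeroʳ _)))) -0#≈0#)

-- Combinations of weighted homogeneous polynomials.

module WeightedPolynomials {c ℓ₁ ℓ₂} (K : HeytingField c ℓ₁ ℓ₂) (char0 : CharacteristicZero K)
  (weight : ℕ → ℕ → ℕ → HeytingField.Carrier K) (degree : ℕ → ℕ → ℕ → ℕ) where

  open LegendreGouldHopperSheffer K char0
  open PolynomialCoefficients K char0
  open CommutativeRing 𝔽 hiding (zero)
  open 𝕂ₛ using (_·_; Σ≤; _∘ₛ_)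
  open ≈-Reasoning setoid
  open SeriesProperties 𝔽
  open Mult semiring using (×-congʳ; ×-comm-*; ×1-homo-*)
  open NaturalCoefficientsSolver commutativeSemiring using (solve; _:=_; _:*_)
  open CommutativeSemigroupProperties *-commutativeSemigroup using (x∙yz≈y∙xz)

  private
    module Sₛ = CommutativeRing seriesCommutativeRing
  open RawRing 𝕂ₛ.seriesRing using () renaming (_≈_ to _≈ₛ_; _*_ to _*ₛ_; 1# to 1ₛ)
  open RawSemiringDefinitions (RawRing.rawSemiring 𝕂ₛ.seriesRing) using () renaming (_^_ to _^ₛ_; _×_ to _·ₛ_)
  open Exp Sₛ.commutativeSemiring using (^-homo-*)

  -- p ~ L says that p = Σ_m L m h_m, where h_m is the weighted sum of all monomials of degree m.
  infix 4 _~_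
  record _~_ (p : Poly) (L : ℕ → 𝕂) : Set (c ⊔ ℓ₁) where
    constructor weighted
    field
      coefficients : ∀ i j k → coeff p i j k ≈ weight i j k * L (degree i j k)
  open _~_ public

  ~-cong : ∀ {p} {L L′ : ℕ → 𝕂} → (∀ m → L m ≈ L′ m) → p ~ L → p ~ L′
  ~-cong L≈L′ p~L = weighted λ i j k →
    trans (coefficients p~L i j k) (*-congˡ (L≈L′ (degree i j k)))

  -- The maps h_m ↦ h_{m-1} and h_m ↦ (m+1) h_{m+1} transposed to the sequence of coefficients L. In
  -- the second, the factor m erases the value at `pred 0`.
  IsLowering IsRaising : Operator → Set _
  IsLowering T = ∀ p L → p ~ L → T p ~ (λ m → L (suc m))
  IsRaising M  = ∀ p L → p ~ L → M p ~ (λ m → m · L (pred m))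

  ^-lowering : ∀ T → IsLowering T → ∀ {p L} → p ~ L → ∀ k → (T ^ᵒ k) p ~ (λ m → L (k ℕ.+ m))
  ^-lowering T lowering         p~L zero    = p~L
  ^-lowering T lowering {p} {L} p~L (suc k) =
    ~-cong (λ m → reflexive (≡.cong L (ℕₚ.+-suc k m)))
      (lowering ((T ^ᵒ k) p) (λ m → L (k ℕ.+ m)) (^-lowering T lowering p~L k))

  -- The definition of `φ ⟦ T ⟧` stops at a total degree, whereas L vanishes beyond n.
  -- `LowersDegree` shows that the terms past the first bound are zero, the vanishing of L that
  -- those past the second are; both are assumed since `degree` is weighted and need not be the
  -- total degree.
  ⟦⟧-lowering : ∀ T → IsLowering T → LowersDegree T →
    ∀ n φ {p L} → p ~ L → (∀ m → n < m → L m ≈ 0#) →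
    (φ ⟦ T ⟧) p ~ (λ m → Σ≤ n (λ k → φ k * L (k ℕ.+ m)))
  ⟦⟧-lowering T lowering lowers n φ {p} {L} p~L L≈0 = weighted λ i j l → begin
    coeff ((φ ⟦ T ⟧) p) i j l
      ≈⟨ coeff-Σ≤ (degreeBound p) (λ k → scalar (φ k) *ₚ (T ^ᵒ k) p) i j l ⟩
    Σ≤ (degreeBound p) (λ k → coeff (scalar (φ k) *ₚ (T ^ᵒ k) p) i j l)
      ≈⟨ Σ≤-cong (degreeBound p) (λ k _ → coeff-scalar-* (φ k) ((T ^ᵒ k) p) i j l) ⟩
    Σ≤ (degreeBound p) (λ k → φ k * coeff ((T ^ᵒ k) p) i j l)
      ≈⟨ Σ≤-bound-irrelevant (degreeBound p) n (λ k → φ k * coeff ((T ^ᵒ k) p) i j l)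
           (λ k lt → trans (*-congˡ (beyondDegree i j l k lt)) (zeroʳ (φ k)))
           (λ k lt → trans (*-congˡ (beyondOrder i j l k lt)) (zeroʳ (φ k))) ⟩
    Σ≤ n (λ k → φ k * coeff ((T ^ᵒ k) p) i j l)
      ≈⟨ Σ≤-cong n (λ k _ → begin
           φ k * coeff ((T ^ᵒ k) p) i j l
             ≈⟨ *-congˡ (coefficients (^-lowering T lowering p~L k) i j l) ⟩
           φ k * (weight i j l * L (k ℕ.+ degree i j l))
             ≈⟨ x∙yz≈y∙xz _ _ _ ⟩
           weight i j l * (φ k * L (k ℕ.+ degree i j l)) ∎) ⟩
    Σ≤ n (λ k → weight i j l * (φ k * L (k ℕ.+ degree i j l)))
      ≈⟨ *-distribˡ-Σ≤ n (weight i j l) (λ k → φ k * L (k ℕ.+ degree i j l)) ⟨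
    weight i j l * Σ≤ n (λ k → φ k * L (k ℕ.+ degree i j l)) ∎
    where
    beyondDegree : ∀ i j l k → degreeBound p < k → coeff ((T ^ᵒ k) p) i j l ≈ 0#
    beyondDegree i j l k lt = power-vanishes {T = T} lowers k 0 p
      (λ i j l le → vanishes-beyond-degreeBound p i j l
        (ℕₚ.≤-trans lt (ℕₚ.≤-trans (ℕₚ.m≤m+n k 0) le)))
      i j l z≤n

    beyondOrder : ∀ i j l k → n < k → coeff ((T ^ᵒ k) p) i j l ≈ 0#
    beyondOrder i j l k lt = trans (coefficients (^-lowering T lowering p~L k) i j l)
      (trans (*-congˡ (L≈0 _ (ℕₚ.≤-trans lt (ℕₚ.m≤m+n k _)))) (zeroʳ _))

  module _ {u : Series} (u₀≈0 : u 0 ≈ 0#) (s : 𝕂) (n : ℕ) where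

    -- For v = 1 this is the sequence of the n-th polynomial, with s its normalisation. The
    -- operators change v only.
    moment : Series → ℕ → 𝕂
    moment v m = s * (v *ₛ (u ^ₛ m)) n

    moment-cong : ∀ {v v′} → v ≈ₛ v′ → ∀ m → moment v m ≈ moment v′ m
    moment-cong v≈v′ m = *-congˡ (Sₛ.*-congʳ {u ^ₛ m} v≈v′ n)

    moment-vanishes : ∀ v m → n < m → moment v m ≈ 0#
    moment-vanishes v m n<m = trans (*-congˡ (order-*-^ {u} v u₀≈0 m n n<m)) (zeroʳ s)

    -- The left side is what `⟦⟧-lowering` produces: φ of a lowering operator multiplies v by φ(u).
    -- The bound n is long enough because u has no constant term.
    moment-∘ₛ : ∀ v φ m →
      Σ≤ n (λ k → φ k * moment v (k ℕ.+ m)) ≈ moment (v *ₛ (φ ∘ₛ u)) m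
    moment-∘ₛ v φ m = begin
      Σ≤ n (λ k → φ k * (s * (v *ₛ (u ^ₛ (k ℕ.+ m))) n))
        ≈⟨ Σ≤-cong n (λ k _ → begin
             φ k * (s * (v *ₛ (u ^ₛ (k ℕ.+ m))) n)
               ≈⟨ x∙yz≈y∙xz _ _ _ ⟩
             s * (φ k * (v *ₛ (u ^ₛ (k ℕ.+ m))) n)
               ≈⟨ *-congˡ (*-congˡ (split k n)) ⟩
             s * (φ k * ((v *ₛ (u ^ₛ m)) *ₛ (u ^ₛ k)) n) ∎) ⟩
      Σ≤ n (λ k → s * (φ k * ((v *ₛ (u ^ₛ m)) *ₛ (u ^ₛ k)) n))
        ≈⟨ *-distribˡ-Σ≤ n s (λ k → φ k * ((v *ₛ (u ^ₛ m)) *ₛ (u ^ₛ k)) n) ⟨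
      s * Σ≤ n (λ k → φ k * ((v *ₛ (u ^ₛ m)) *ₛ (u ^ₛ k)) n)
        ≈⟨ *-congˡ (*-∘ₛ {u} (v *ₛ (u ^ₛ m)) φ u₀≈0 n) ⟨
      s * ((v *ₛ (u ^ₛ m)) *ₛ (φ ∘ₛ u)) n
        ≈⟨ *-congˡ (xy∙z≈xz∙y v (u ^ₛ m) (φ ∘ₛ u) n) ⟩
      s * ((v *ₛ (φ ∘ₛ u)) *ₛ (u ^ₛ m)) n ∎
      where
      open CommutativeSemigroupProperties Sₛ.*-commutativeSemigroup using (xy∙z≈xz∙y)

      split : ∀ k → (v *ₛ (u ^ₛ (k ℕ.+ m))) ≈ₛ ((v *ₛ (u ^ₛ m)) *ₛ (u ^ₛ k))
      split k = Sₛ.trans (Sₛ.*-congˡ {v} (Sₛ.trans (^-homo-* u k m) (Sₛ.*-comm (u ^ₛ k) (u ^ₛ m))))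
        (Sₛ.sym (Sₛ.*-assoc v (u ^ₛ m) (u ^ₛ k)))

    -- By the power rule m θ(u) u^(m-1) = θ(u^m), and θ multiplies the coefficient of t^n by n. This
    -- is where the eigenvalue comes from.
    moment-θ : ∀ m → m · moment (θ u) (pred m) ≈ n · moment 1ₛ m
    moment-θ m = begin
      m · (s * (θ u *ₛ (u ^ₛ pred m)) n)
        ≈⟨ ×-comm-* m s _ ⟨
      s * (m · (θ u *ₛ (u ^ₛ pred m)) n)
        ≡⟨ ≡.cong (s *_) (·ₛ-coefficient m (θ u *ₛ (u ^ₛ pred m)) n) ⟨
      s * (m ·ₛ (θ u *ₛ (u ^ₛ pred m))) n
        ≈⟨ *-congˡ (θ-^ u m n) ⟨
      s * (n · (u ^ₛ m) n)
        ≈⟨ ×-comm-* n s _ ⟩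
      n · (s * (u ^ₛ m) n)
        ≈⟨ ×-congʳ n (*-congˡ (Sₛ.*-identityˡ (u ^ₛ m) n)) ⟨
      n · moment 1ₛ m ∎

    -- The multiplier v passes from 1 to (1/f')(u) and then, by `θ-inverse`, to θ u; `moment-θ`
    -- finishes. T₁ and T₂ enter only through their action on sequences, so they may differ, as they
    -- do in the second family.
    eigenvector : ∀ {f 1/f′ T₁ T₂ M} →
      (f ∘ₛ u) ≈ₛ 𝕂ₛ.t → (𝕂ₛ.derivative f *ₛ 1/f′) ≈ₛ 1ₛ →
      IsLowering T₁ → LowersDegree T₁ → IsLowering T₂ → LowersDegree T₂ → IsRaising M →
      ∀ {p} → p ~ (λ m → s * (u ^ₛ m) n) →
      (M ((f ⟦ T₁ ⟧) ((1/f′ ⟦ T₂ ⟧) p)) -ₚ (n ·ₚ p)) ≈ₚ 0ₚ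
    eigenvector {f} {1/f′} {T₁} {T₂} {M} fu≈t f′/f′≈1 low₁ deg₁ low₂ deg₂ raising {p} p~ i j k = begin
      coeff (Mq -ₚ (n ·ₚ p)) i j k
        ≈⟨ coeff-++ Mq (-ₚ (n ·ₚ p)) i j k ⟩
      coeff Mq i j k + coeff (-ₚ (n ·ₚ p)) i j k
        ≈⟨ +-cong lhs (trans (coeff-negate (n ·ₚ p) i j k) (-‿cong (coeff-·ₚ n p i j k))) ⟩
      n · coeff p i j k + - (n · coeff p i j k)
        ≈⟨ -‿inverseʳ _ ⟩
      0# ∎
      where
      Mq : Poly
      Mq = M ((f ⟦ T₁ ⟧) ((1/f′ ⟦ T₂ ⟧) p))

      p~₀ : p ~ moment 1ₛ
      p~₀ = ~-cong (λ m → *-congˡ (sym (Sₛ.*-identityˡ (u ^ₛ m) n))) p~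

      v₁ v₂ : Series
      v₁ = 1ₛ *ₛ (1/f′ ∘ₛ u)
      v₂ = v₁ *ₛ (f ∘ₛ u)

      p~₁ : (1/f′ ⟦ T₂ ⟧) p ~ moment v₁
      p~₁ = ~-cong (moment-∘ₛ 1ₛ 1/f′)
        (⟦⟧-lowering T₂ low₂ deg₂ n 1/f′ p~₀ (moment-vanishes 1ₛ))

      p~₂ : (f ⟦ T₁ ⟧) ((1/f′ ⟦ T₂ ⟧) p) ~ moment (θ u)
      p~₂ = ~-cong
        (λ m → trans (moment-∘ₛ v₁ f m) (moment-cong v₂≈θu m))
        (⟦⟧-lowering T₁ low₁ deg₁ n f p~₁ (moment-vanishes v₁))
        where
        v₂≈θu : v₂ ≈ₛ θ u
        v₂≈θu = Sₛ.trans (Sₛ.*-congʳ {f ∘ₛ u} (Sₛ.*-identityˡ (1/f′ ∘ₛ u)))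
          (Sₛ.sym (θ-inverse 𝔽 {f} {u} {1/f′} u₀≈0 fu≈t f′/f′≈1))

      lhs : coeff Mq i j k ≈ n · coeff p i j k
      lhs = begin
        coeff Mq i j k
          ≈⟨ coefficients (raising _ _ p~₂) i j k ⟩
        weight i j k * (degree i j k · moment (θ u) (pred (degree i j k)))
          ≈⟨ *-congˡ (moment-θ (degree i j k)) ⟩
        weight i j k * (n · moment 1ₛ (degree i j k))
          ≈⟨ ×-comm-* n _ _ ⟩
        n · (weight i j k * moment 1ₛ (degree i j k))
          ≈⟨ ×-congʳ n (coefficients p~₀ i j k) ⟨
        n · coeff p i j k ∎

  -- The operator T^r lowers the degree by r and z raises it by r + 1, a net gain of one. The factor
  -- r + 1 together with the exponent k recovered from 1/k! is the share (r+1)k of z in the degree.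
  z-raises : ∀ T r → IsLowering T →
    (∀ i j k → weight i j k ≈ ι (suc k) * weight i j (suc k)) →
    (∀ i j k → degree i j (suc k) ≡ suc r ℕ.+ degree i j k) →
    ∀ {p L} → p ~ L → ∀ i j k →
    coeff (suc r ·ₚ (z *ₚ (T ^ᵒ r) p)) i j k
      ≈ weight i j k * (ι (suc r ℕ.* k) * L (pred (degree i j k)))
  z-raises T r lowering weight-z degree-z {p} {L} p~L i j zero = begin
    coeff (suc r ·ₚ (z *ₚ (T ^ᵒ r) p)) i j 0
      ≈⟨ coeff-·ₚ (suc r) (z *ₚ (T ^ᵒ r) p) i j 0 ⟩
    suc r · coeff (z *ₚ (T ^ᵒ r) p) i j 0
      ≈⟨ ×-congʳ (suc r) (coeff-z*-zero ((T ^ᵒ r) p) i j) ⟩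
    suc r · 0#
      ≈⟨ ·-zeroʳ (suc r) ⟩
    0#
      ≈⟨ trans (*-congˡ (zeroˡ _)) (zeroʳ _) ⟨
    weight i j 0 * (ι 0 * L (pred (degree i j 0)))
      ≡⟨ ≡.cong (λ m → weight i j 0 * (ι m * L (pred (degree i j 0)))) (ℕₚ.*-zeroʳ r) ⟨
    weight i j 0 * (ι (suc r ℕ.* 0) * L (pred (degree i j 0))) ∎
  z-raises T r lowering weight-z degree-z {p} {L} p~L i j (suc k) = begin
    coeff (suc r ·ₚ (z *ₚ (T ^ᵒ r) p)) i j (suc k)
      ≈⟨ coeff-·ₚ (suc r) (z *ₚ (T ^ᵒ r) p) i j (suc k) ⟩
    suc r · coeff (z *ₚ (T ^ᵒ r) p) i j (suc k)
      ≈⟨ ×-congʳ (suc r) (coeff-z*-suc ((T ^ᵒ r) p) i j k) ⟩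
    suc r · coeff ((T ^ᵒ r) p) i j k
      ≈⟨ ·≈ι* (suc r) _ ⟩
    ι (suc r) * coeff ((T ^ᵒ r) p) i j k
      ≈⟨ *-congˡ (coefficients (^-lowering T lowering p~L r) i j k) ⟩
    ι (suc r) * (weight i j k * L (r ℕ.+ degree i j k))
      ≈⟨ *-congˡ (*-congʳ (weight-z i j k)) ⟩
    ι (suc r) * ((ι (suc k) * weight i j (suc k)) * L (r ℕ.+ degree i j k))
      ≈⟨ solve 4 (λ a b v l → a :* ((b :* v) :* l) := v :* ((a :* b) :* l)) refl
           (ι (suc r)) (ι (suc k)) (weight i j (suc k)) (L (r ℕ.+ degree i j k)) ⟩
    weight i j (suc k) * ((ι (suc r) * ι (suc k)) * L (r ℕ.+ degree i j k))
      ≈⟨ *-congˡ (*-congʳ (×1-homo-* (suc r) (suc k))) ⟨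
    weight i j (suc k) * (ι (suc r ℕ.* suc k) * L (r ℕ.+ degree i j k))
      ≡⟨ ≡.cong (λ m → weight i j (suc k) * (ι (suc r ℕ.* suc k) * L (pred m))) (degree-z i j k) ⟨
    weight i j (suc k) * (ι (suc r ℕ.* suc k) * L (pred (degree i j (suc k)))) ∎

-- Weights and degrees of the monomials in the two families.

module MonomialWeights {c ℓ₁ ℓ₂} (K : HeytingField c ℓ₁ ℓ₂) (char0 : CharacteristicZero K) where

  open LegendreGouldHopperSheffer K char0
  open PolynomialCoefficients K char0
  open CommutativeRing 𝔽 hiding (zero)
  open RingProperties ring using (-‿distribˡ-*; -‿involutive; -1*x≈-x)
  open 𝕂ₛ using (_^_)
  open NaturalCoefficientsSolver commutativeSemiring using (solve; _:=_; _:*_)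

  1/!-suc : ∀ n → 1/ n ! ≈ ι (suc n) * 1/ suc n !
  1/!-suc n = sym (trans (sym (*-assoc _ _ _)) (trans (*-congʳ (ι-*-1/suc n)) (*-identityˡ _)))

  1/!²-suc : ∀ n → 1/ n ! * 1/ n ! ≈ ι (suc n) * ι (suc n) * (1/ suc n ! * 1/ suc n !)
  1/!²-suc n = trans (*-cong (1/!-suc n) (1/!-suc n))
    (solve 2 (λ a b → (a :* b) :* (a :* b) := (a :* a) :* (b :* b)) refl (ι (suc n)) (1/ suc n !))

  -- The sign comes from (-1)^n = -(-1)^(n+1). It is the one that compensates the minus in front of
  -- `∂/∂Dx⁻¹` and `Dx⁻¹` in the second equation.
  C₀-suc : ∀ n → C₀ n ≈ - (ι (suc n) * ι (suc n) * C₀ (suc n))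
  C₀-suc n = begin
    s * (1/ n ! * 1/ n !)
      ≈⟨ *-cong (trans (sym (-‿involutive s)) (-‿cong (sym (-1*x≈-x s)))) (1/!²-suc n) ⟩
    - (- 1# * s) * (ι (suc n) * ι (suc n) * (1/ suc n ! * 1/ suc n !))
      ≈⟨ -‿distribˡ-* _ _ ⟨
    - ((- 1# * s) * (ι (suc n) * ι (suc n) * (1/ suc n ! * 1/ suc n !)))
      ≈⟨ -‿cong (solve 3 (λ s a b → s :* (a :* b) := a :* (s :* b)) refl
           (- 1# * s) (ι (suc n) * ι (suc n)) (1/ suc n ! * 1/ suc n !)) ⟩
    - (ι (suc n) * ι (suc n) * C₀ (suc n)) ∎
    where
    open ≈-Reasoning setoid
    s = (- 1#) ^ n

  -- The coefficient of x^i y^j z^k with its power of u removed. In the first family the sign of C₀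
  -- cancels against the argument -x u²; in the second, x u keeps the sign (-1)^i while -y u loses
  -- its own.
  weightˢ weightʳ : ℕ → ℕ → ℕ → 𝕂
  weightˢ i j k = (1/ i ! * 1/ i !) * (1/ j ! * 1/ k !)
  weightʳ i j k = (C₀ i * (1/ j ! * 1/ j !)) * 1/ k !

  degreeˢ degreeʳ : ℕ → ℕ → ℕ → ℕ → ℕ
  degreeˢ r i j k = (i ℕ.+ i) ℕ.+ (j ℕ.+ r ℕ.* k)
  degreeʳ r i j k = i ℕ.+ (j ℕ.+ r ℕ.* k)

-- Lowering and raising operators of the two families.

module LegendreOperators {c ℓ₁ ℓ₂} (K : HeytingField c ℓ₁ ℓ₂) (char0 : CharacteristicZero K) (r : ℕ) where

  open LegendreGouldHopperSheffer K char0
  open PolynomialCoefficients K char0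
  open MonomialWeights K char0
  open CommutativeRing 𝔽 hiding (zero)
  open RingProperties ring using (-‿distribˡ-*; -‿distribʳ-*; -‿involutive; -0#≈0#)
  open 𝕂ₛ using (_·_)
  open ≈-Reasoning setoid
  open Mult semiring using (×-congʳ; ×-homo-+)
  open NaturalCoefficientsSolver commutativeSemiring using (solve; _:=_; _:*_; _:+_)

  -- The exponent in the generating functions is `suc r`, so the order `suc r ∸ 1` of the derivative
  -- in the raising operators computes to `r`.
  module S = WeightedPolynomials K char0 weightˢ (degreeˢ (suc r))
  module R = WeightedPolynomials K char0 weightʳ (degreeʳ (suc r))

  private
    dˢ dʳ : ℕ → ℕ → ℕ → ℕ
    dˢ = degreeˢ (suc r)
    dʳ = degreeʳ (suc r)

  degreeˢ-x : ∀ i j k → dˢ (suc i) j k ≡ suc (suc (dˢ i j k))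
  degreeˢ-x i j k = ≡.cong (λ m → suc (m ℕ.+ (j ℕ.+ suc r ℕ.* k))) (ℕₚ.+-suc i i)

  degreeˢ-y : ∀ i j k → dˢ i (suc j) k ≡ suc (dˢ i j k)
  degreeˢ-y i j k = ℕₚ.+-suc (i ℕ.+ i) _

  degreeʳ-y : ∀ i j k → dʳ i (suc j) k ≡ suc (dʳ i j k)
  degreeʳ-y i j k = ℕₚ.+-suc i _

  private
    shift-z : ∀ a j k → a ℕ.+ (j ℕ.+ suc r ℕ.* suc k) ≡ suc r ℕ.+ (a ℕ.+ (j ℕ.+ suc r ℕ.* k))
    shift-z a j k = ≡.trans
      (≡.cong (λ m → a ℕ.+ (j ℕ.+ m)) (ℕₚ.*-suc (suc r) k))
      (≡.trans (≡.cong (a ℕ.+_) (x∙yz≈y∙xz j (suc r) _)) (x∙yz≈y∙xz a (suc r) _))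
      where open CommutativeSemigroupProperties ℕₚ.+-commutativeSemigroup using (x∙yz≈y∙xz)

  weightˢ-x : ∀ i j k → weightˢ i j k ≈ ι (suc i) * ι (suc i) * weightˢ (suc i) j k
  weightˢ-x i j k = trans (*-congʳ (1/!²-suc i)) (*-assoc _ _ _)

  weightˢ-y : ∀ i j k → weightˢ i j k ≈ ι (suc j) * weightˢ i (suc j) k
  weightˢ-y i j k = trans (*-congˡ (*-congʳ (1/!-suc j)))
    (solve 4 (λ a n b d → a :* ((n :* b) :* d) := n :* (a :* (b :* d))) refl _ _ _ _)

  weightˢ-z : ∀ i j k → weightˢ i j k ≈ ι (suc k) * weightˢ i j (suc k)
  weightˢ-z i j k = trans (*-congˡ (*-congˡ (1/!-suc k)))
    (solve 4 (λ a n b d → a :* (b :* (n :* d)) := n :* (a :* (b :* d))) refl _ _ _ _)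

  weightʳ-x : ∀ i j k → weightʳ i j k ≈ - (ι (suc i) * ι (suc i) * weightʳ (suc i) j k)
  weightʳ-x i j k = begin
    C₀ i * b * e
      ≈⟨ *-congʳ (*-congʳ (C₀-suc i)) ⟩
    - (n * C₀ (suc i)) * b * e
      ≈⟨ *-congʳ (-‿distribˡ-* _ _) ⟨
    - (n * C₀ (suc i) * b) * e
      ≈⟨ -‿distribˡ-* _ _ ⟨
    - (n * C₀ (suc i) * b * e)
      ≈⟨ -‿cong (solve 4 (λ n a b e → n :* a :* b :* e := n :* (a :* b :* e)) refl n (C₀ (suc i)) b e) ⟩
    - (n * (C₀ (suc i) * b * e)) ∎
    where
    n = ι (suc i) * ι (suc i)
    b = 1/ j ! * 1/ j !
    e = 1/ k !

  weightʳ-y : ∀ i j k → weightʳ i j k ≈ ι (suc j) * ι (suc j) * weightʳ i (suc j) k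
  weightʳ-y i j k = trans (*-congʳ (*-congˡ (1/!²-suc j)))
    (solve 4 (λ a n b d → (a :* (n :* b)) :* d := n :* ((a :* b) :* d)) refl _ _ _ _)

  weightʳ-z : ∀ i j k → weightʳ i j k ≈ ι (suc k) * weightʳ i j (suc k)
  weightʳ-z i j k = trans (*-congˡ (1/!-suc k))
    (solve 3 (λ a n b → a :* (n :* b) := n :* (a :* b)) refl _ _ _)

  ∂y-loweringˢ : S.IsLowering ∂y
  ∂y-loweringˢ p L p~L = S.weighted λ i j k → begin
    coeff (∂y p) i j k
      ≈⟨ coeff-∂y p i j k ⟩
    ι (suc j) * coeff p i (suc j) k
      ≈⟨ *-congˡ (S.coefficients p~L i (suc j) k) ⟩
    ι (suc j) * (weightˢ i (suc j) k * L (dˢ i (suc j) k))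
      ≈⟨ *-assoc _ _ _ ⟨
    ι (suc j) * weightˢ i (suc j) k * L (dˢ i (suc j) k)
      ≈⟨ *-cong (sym (weightˢ-y i j k)) (reflexive (≡.cong L (degreeˢ-y i j k))) ⟩
    weightˢ i j k * L (suc (dˢ i j k)) ∎

  ∂/∂Dy⁻¹-loweringʳ : R.IsLowering ∂/∂Dy⁻¹
  ∂/∂Dy⁻¹-loweringʳ p L p~L = R.weighted λ i j k → begin
    coeff (∂/∂Dy⁻¹ p) i j k
      ≈⟨ coeff-∂/∂Dy⁻¹ p i j k ⟩
    ι (suc j) * (ι (suc j) * coeff p i (suc j) k)
      ≈⟨ *-congˡ (*-congˡ (R.coefficients p~L i (suc j) k)) ⟩
    ι (suc j) * (ι (suc j) * (weightʳ i (suc j) k * L (dʳ i (suc j) k)))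
      ≈⟨ solve 3 (λ n v l → n :* (n :* (v :* l)) := (n :* n :* v) :* l) refl _ _ _ ⟩
    ι (suc j) * ι (suc j) * weightʳ i (suc j) k * L (dʳ i (suc j) k)
      ≈⟨ *-cong (sym (weightʳ-y i j k)) (reflexive (≡.cong L (degreeʳ-y i j k))) ⟩
    weightʳ i j k * L (suc (dʳ i j k)) ∎

  -- Differentiating, multiplying by x and differentiating again takes x^(i+1)/((i+1)!)² to
  -- x^i/(i!)². Since consecutive weights alternate in sign, the minus is exactly what makes the
  -- operator lowering.
  -∂/∂Dx⁻¹-loweringʳ : R.IsLowering (λ q → -ₚ ∂/∂Dx⁻¹ q)
  -∂/∂Dx⁻¹-loweringʳ p L p~L = R.weighted λ i j k → begin
    coeff (-ₚ ∂/∂Dx⁻¹ p) i j k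
      ≈⟨ coeff-negate (∂/∂Dx⁻¹ p) i j k ⟩
    - coeff (∂/∂Dx⁻¹ p) i j k
      ≈⟨ -‿cong (coeff-∂/∂Dx⁻¹ p i j k) ⟩
    - (ι (suc i) * (ι (suc i) * coeff p (suc i) j k))
      ≈⟨ -‿cong (*-congˡ (*-congˡ (R.coefficients p~L (suc i) j k))) ⟩
    - (ι (suc i) * (ι (suc i) * (weightʳ (suc i) j k * L (suc (dʳ i j k)))))
      ≈⟨ -‿cong (solve 3 (λ n v l → n :* (n :* (v :* l)) := (n :* n :* v) :* l) refl _ _ _) ⟩
    - (ι (suc i) * ι (suc i) * weightʳ (suc i) j k * L (suc (dʳ i j k)))
      ≈⟨ -‿distribˡ-* _ _ ⟩
    - (ι (suc i) * ι (suc i) * weightʳ (suc i) j k) * L (suc (dʳ i j k))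
      ≈⟨ *-congʳ (weightʳ-x i j k) ⟨
    weightʳ i j k * L (suc (dʳ i j k)) ∎

  private
    -- Each summand of a raising operator yields the share of one variable in the weighted degree.
    -- Their sum is the whole degree, as in Euler's relation for homogeneous polynomials.
    collect : ∀ v a b d l →
      v * (ι a * l) + v * (ι b * l) + v * (ι d * l) ≈ v * (ι (a ℕ.+ (b ℕ.+ d)) * l)
    collect v a b d l = begin
      v * (ι a * l) + v * (ι b * l) + v * (ι d * l)
        ≈⟨ solve 5 (λ v a b d l → v :* (a :* l) :+ v :* (b :* l) :+ v :* (d :* l)
             := v :* ((a :+ (b :+ d)) :* l)) refl v (ι a) (ι b) (ι d) l ⟩
      v * ((ι a + (ι b + ι d)) * l)
        ≈⟨ *-congˡ (*-congʳ (trans (×-homo-+ 1# a (b ℕ.+ d)) (+-congˡ (×-homo-+ 1# b d)))) ⟨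
      v * (ι (a ℕ.+ (b ℕ.+ d)) * l) ∎

  y-raisesˢ : ∀ {p L} → p S.~ L → ∀ i j k →
    coeff (y *ₚ p) i j k ≈ weightˢ i j k * (ι j * L (pred (dˢ i j k)))
  y-raisesˢ {p} {L} p~L i zero    k = trans (coeff-y*-zero p i k)
    (sym (trans (*-congˡ (zeroˡ _)) (zeroʳ _)))
  y-raisesˢ {p} {L} p~L i (suc j) k = begin
    coeff (y *ₚ p) i (suc j) k
      ≈⟨ coeff-y*-suc p i j k ⟩
    coeff p i j k
      ≈⟨ S.coefficients p~L i j k ⟩
    weightˢ i j k * L (dˢ i j k)
      ≈⟨ *-congʳ (weightˢ-y i j k) ⟩
    ι (suc j) * weightˢ i (suc j) k * L (dˢ i j k)
      ≈⟨ solve 3 (λ n v l → n :* v :* l := v :* (n :* l)) refl _ _ _ ⟩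
    weightˢ i (suc j) k * (ι (suc j) * L (dˢ i j k))
      ≡⟨ ≡.cong (λ m → weightˢ i (suc j) k * (ι (suc j) * L (pred m))) (degreeˢ-y i j k) ⟨
    weightˢ i (suc j) k * (ι (suc j) * L (pred (dˢ i (suc j) k))) ∎

  -- In degree, `∂y` costs one and x gains two. Of the factor (i+1)² between consecutive weights,
  -- `Dx⁻¹` cancels one i+1; the other, doubled by the constant 2, is the share of x, which has
  -- degree 2.
  2Dx⁻¹∂y-raisesˢ : ∀ {p L} → p S.~ L → ∀ i j k →
    coeff (2 ·ₚ Dx⁻¹ (∂y p)) i j k ≈ weightˢ i j k * (ι (i ℕ.+ i) * L (pred (dˢ i j k)))
  2Dx⁻¹∂y-raisesˢ {p} {L} p~L zero j k = begin
    coeff (2 ·ₚ Dx⁻¹ (∂y p)) 0 j k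
      ≈⟨ coeff-·ₚ 2 (Dx⁻¹ (∂y p)) 0 j k ⟩
    2 · coeff (Dx⁻¹ (∂y p)) 0 j k
      ≈⟨ trans (×-congʳ 2 (coeff-Dx⁻¹-zero (∂y p) j k)) (trans (+-identityˡ _) (+-identityˡ _)) ⟩
    0#
      ≈⟨ trans (*-congˡ (zeroˡ _)) (zeroʳ _) ⟨
    weightˢ 0 j k * (0# * L (pred (dˢ 0 j k))) ∎
  2Dx⁻¹∂y-raisesˢ {p} {L} p~L (suc i) j k = begin
    coeff (2 ·ₚ Dx⁻¹ (∂y p)) (suc i) j k
      ≈⟨ coeff-·ₚ 2 (Dx⁻¹ (∂y p)) (suc i) j k ⟩
    2 · coeff (Dx⁻¹ (∂y p)) (suc i) j k
      ≈⟨ ×-congʳ 2 (coeff-Dx⁻¹-suc (∂y p) i j k) ⟩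
    2 · (1/suc i * coeff (∂y p) i j k)
      ≈⟨ +-congˡ (+-identityʳ _) ⟩
    1/suc i * coeff (∂y p) i j k + 1/suc i * coeff (∂y p) i j k
      ≈⟨ +-cong half half ⟩
    v * (ι (suc i) * l) + v * (ι (suc i) * l)
      ≈⟨ trans (*-congˡ (distribʳ _ _ _)) (distribˡ _ _ _) ⟨
    v * ((ι (suc i) + ι (suc i)) * l)
      ≈⟨ *-congˡ (*-congʳ (×-homo-+ 1# (suc i) (suc i))) ⟨
    v * (ι (suc i ℕ.+ suc i) * l) ∎
    where
    v l : 𝕂
    v = weightˢ (suc i) j k
    l = L (pred (dˢ (suc i) j k))

    half : 1/suc i * coeff (∂y p) i j k ≈ v * (ι (suc i) * l)
    half = begin
      1/suc i * coeff (∂y p) i j k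
        ≈⟨ *-congˡ (S.coefficients (∂y-loweringˢ p L p~L) i j k) ⟩
      1/suc i * (weightˢ i j k * L (suc (dˢ i j k)))
        ≡⟨ ≡.cong (λ m → 1/suc i * (weightˢ i j k * L (pred m))) (degreeˢ-x i j k) ⟨
      1/suc i * (weightˢ i j k * l)
        ≈⟨ *-congˡ (*-congʳ (weightˢ-x i j k)) ⟩
      1/suc i * ((ι (suc i) * ι (suc i) * v) * l)
        ≈⟨ solve 4 (λ q n v l → q :* ((n :* n :* v) :* l) := (n :* q) :* (v :* (n :* l))) refl _ _ _ _ ⟩
      (ι (suc i) * 1/suc i) * (v * (ι (suc i) * l))
        ≈⟨ trans (*-congʳ (ι-*-1/suc i)) (*-identityˡ _) ⟩
      v * (ι (suc i) * l) ∎

  raisingˢ : S.IsRaising (sLeG-M (suc r))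
  raisingˢ p L p~L = S.weighted λ i j k → begin
    coeff (sLeG-M (suc r) p) i j k
      ≈⟨ trans (coeff-++ ((y *ₚ p) +ₚ (2 ·ₚ Dx⁻¹ (∂y p))) zpart i j k)
           (+-congʳ (coeff-++ (y *ₚ p) (2 ·ₚ Dx⁻¹ (∂y p)) i j k)) ⟩
    coeff (y *ₚ p) i j k + coeff (2 ·ₚ Dx⁻¹ (∂y p)) i j k + coeff zpart i j k
      -- The parts of x and y are exchanged to match the order of the summands in `degreeˢ`.
      ≈⟨ +-cong (trans (+-comm _ _) (+-cong (2Dx⁻¹∂y-raisesˢ p~L i j k) (y-raisesˢ p~L i j k)))
           (S.z-raises ∂y r ∂y-loweringˢ weightˢ-z (λ i → shift-z (i ℕ.+ i)) p~L i j k) ⟩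
    weightˢ i j k * (ι (i ℕ.+ i) * L (pred (dˢ i j k)))
      + weightˢ i j k * (ι j * L (pred (dˢ i j k)))
      + weightˢ i j k * (ι (suc r ℕ.* k) * L (pred (dˢ i j k)))
      ≈⟨ collect (weightˢ i j k) (i ℕ.+ i) j (suc r ℕ.* k) (L (pred (dˢ i j k))) ⟩
    weightˢ i j k * (ι (dˢ i j k) * L (pred (dˢ i j k)))
      ≈⟨ *-congˡ (·≈ι* (dˢ i j k) _) ⟨
    weightˢ i j k * (dˢ i j k · L (pred (dˢ i j k))) ∎
    where
    zpart : Poly
    zpart = suc r ·ₚ (z *ₚ (∂y ^ᵒ r) p)

  Dy⁻¹-raisesʳ : ∀ {p L} → p R.~ L → ∀ i j k →
    coeff (Dy⁻¹ p) i j k ≈ weightʳ i j k * (ι j * L (pred (dʳ i j k)))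
  Dy⁻¹-raisesʳ {p} {L} p~L i zero    k = trans (coeff-Dy⁻¹-zero p i k)
    (sym (trans (*-congˡ (zeroˡ _)) (zeroʳ _)))
  Dy⁻¹-raisesʳ {p} {L} p~L i (suc j) k = begin
    coeff (Dy⁻¹ p) i (suc j) k
      ≈⟨ coeff-Dy⁻¹-suc p i j k ⟩
    1/suc j * coeff p i j k
      ≈⟨ *-congˡ (R.coefficients p~L i j k) ⟩
    1/suc j * (weightʳ i j k * L (dʳ i j k))
      ≈⟨ *-congˡ (*-congʳ (weightʳ-y i j k)) ⟩
    1/suc j * ((ι (suc j) * ι (suc j) * weightʳ i (suc j) k) * L (dʳ i j k))
      ≈⟨ solve 4 (λ q n v l → q :* ((n :* n :* v) :* l) := (n :* q) :* (v :* (n :* l))) refl _ _ _ _ ⟩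
    (ι (suc j) * 1/suc j) * (weightʳ i (suc j) k * (ι (suc j) * L (dʳ i j k)))
      ≈⟨ trans (*-congʳ (ι-*-1/suc j)) (*-identityˡ _) ⟩
    weightʳ i (suc j) k * (ι (suc j) * L (dʳ i j k))
      ≡⟨ ≡.cong (λ m → weightʳ i (suc j) k * (ι (suc j) * L (pred m))) (degreeʳ-y i j k) ⟨
    weightʳ i (suc j) k * (ι (suc j) * L (pred (dʳ i (suc j) k))) ∎

  -- The minus in the operator meets the minus of `weightʳ-x`, so x contributes its share i with a
  -- positive sign, as y does.
  -Dx⁻¹-raisesʳ : ∀ {p L} → p R.~ L → ∀ i j k →
    coeff (-ₚ Dx⁻¹ p) i j k ≈ weightʳ i j k * (ι i * L (pred (dʳ i j k)))
  -Dx⁻¹-raisesʳ {p} {L} p~L zero    j k = trans (coeff-negate (Dx⁻¹ p) 0 j k)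
    (trans (trans (-‿cong (coeff-Dx⁻¹-zero p j k)) -0#≈0#)
      (sym (trans (*-congˡ (zeroˡ _)) (zeroʳ _))))
  -Dx⁻¹-raisesʳ {p} {L} p~L (suc i) j k = begin
    coeff (-ₚ Dx⁻¹ p) (suc i) j k
      ≈⟨ coeff-negate (Dx⁻¹ p) (suc i) j k ⟩
    - coeff (Dx⁻¹ p) (suc i) j k
      ≈⟨ -‿cong (coeff-Dx⁻¹-suc p i j k) ⟩
    - (1/suc i * coeff p i j k)
      ≈⟨ -‿distribʳ-* _ _ ⟩
    1/suc i * - coeff p i j k
      ≈⟨ *-congˡ (-‿cong (R.coefficients p~L i j k)) ⟩
    1/suc i * - (weightʳ i j k * l)
      ≈⟨ *-congˡ (-‿distribˡ-* _ _) ⟩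
    1/suc i * (- weightʳ i j k * l)
      ≈⟨ *-congˡ (*-congʳ (trans (-‿cong (weightʳ-x i j k)) (-‿involutive _))) ⟩
    1/suc i * ((ι (suc i) * ι (suc i) * weightʳ (suc i) j k) * l)
      ≈⟨ solve 4 (λ q n v l → q :* ((n :* n :* v) :* l) := (n :* q) :* (v :* (n :* l))) refl _ _ _ _ ⟩
    (ι (suc i) * 1/suc i) * (weightʳ (suc i) j k * (ι (suc i) * l))
      ≈⟨ trans (*-congʳ (ι-*-1/suc i)) (*-identityˡ _) ⟩
    weightʳ (suc i) j k * (ι (suc i) * l) ∎
    where
    l : 𝕂
    l = L (dʳ i j k)

  raisingʳ : R.IsRaising (rLeG-M (suc r))
  raisingʳ p L p~L = R.weighted λ i j k → begin
    coeff (rLeG-M (suc r) p) i j k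
      ≈⟨ trans (coeff-++ (Dy⁻¹ p -ₚ Dx⁻¹ p) zpart i j k)
           (+-congʳ (coeff-++ (Dy⁻¹ p) (-ₚ Dx⁻¹ p) i j k)) ⟩
    coeff (Dy⁻¹ p) i j k + coeff (-ₚ Dx⁻¹ p) i j k + coeff zpart i j k
      ≈⟨ +-cong (trans (+-comm _ _) (+-cong (-Dx⁻¹-raisesʳ p~L i j k) (Dy⁻¹-raisesʳ p~L i j k)))
           (R.z-raises ∂/∂Dy⁻¹ r ∂/∂Dy⁻¹-loweringʳ weightʳ-z shift-z p~L i j k) ⟩
    weightʳ i j k * (ι i * L (pred (dʳ i j k)))
      + weightʳ i j k * (ι j * L (pred (dʳ i j k)))
      + weightʳ i j k * (ι (suc r ℕ.* k) * L (pred (dʳ i j k)))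
      ≈⟨ collect (weightʳ i j k) i j (suc r ℕ.* k) (L (pred (dʳ i j k))) ⟩
    weightʳ i j k * (ι (dʳ i j k) * L (pred (dʳ i j k)))
      ≈⟨ *-congˡ (·≈ι* (dʳ i j k) _) ⟨
    weightʳ i j k * (dʳ i j k · L (pred (dʳ i j k))) ∎
    where
    zpart : Poly
    zpart = suc r ·ₚ (z *ₚ (∂/∂Dy⁻¹ ^ᵒ r) p)

-- Monomials in power series and in iterated power series.

module MonomialSeries {c ℓ} (R : CommutativeRing c ℓ) where

  open CommutativeRing R hiding (zero)
  open PowerSeries rawRing
  open SeriesProperties R
  open RingProperties ring using (-0#≈0#)
  open CommutativeSemigroupProperties *-commutativeSemigroup using (interchange)

  private
    module Sₛ = CommutativeRing seriesCommutativeRing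
  open RawRing seriesRing using () renaming
    (_≈_ to _≈ₛ_; _+_ to _+ₛ_; _*_ to _*ₛ_; 1# to 1ₛ; -_ to -ₛ_)
  open RawSemiringDefinitions (RawRing.rawSemiring seriesRing) using () renaming (_^_ to _^ₛ_)

  mon : ℕ → Carrier → Series
  mon m a n = if m ≡ᵇ n then a else 0#

  mon-cong : ∀ m {a b} → a ≈ b → mon m a ≈ₛ mon m b
  mon-cong m a≈b n with m ≡ᵇ n
  ... | true  = a≈b
  ... | false = refl

  mon-+ : ∀ m a b → (mon m a +ₛ mon m b) ≈ₛ mon m (a + b)
  mon-+ m a b n with m ≡ᵇ n
  ... | true  = refl
  ... | false = +-identityˡ 0#

  mon-negate : ∀ m a → (-ₛ mon m a) ≈ₛ mon m (- a)
  mon-negate m a n with m ≡ᵇ n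
  ... | true  = refl
  ... | false = -0#≈0#

  1≈mon : 1ₛ ≈ₛ mon 0 1#
  1≈mon zero    = refl
  1≈mon (suc n) = refl

  mon-0-*ˡ : ∀ a φ n → (mon 0 a *ₛ φ) n ≈ a * φ n
  mon-0-*ˡ a φ n = Σ≤-head n (λ k → mon 0 a k * φ (n ∸ k)) (λ k → zeroˡ (φ (n ∸ suc k)))

  mon-0-*ʳ : ∀ φ a n → (φ *ₛ mon 0 a) n ≈ φ n * a
  mon-0-*ʳ φ a n = trans (*ₛ-comm φ (mon 0 a) n) (trans (mon-0-*ˡ a φ n) (*-comm _ _))

  mon-suc-*-zero : ∀ m a φ → (mon (suc m) a *ₛ φ) 0 ≈ 0#
  mon-suc-*-zero m a φ = trans (+-identityʳ _) (zeroˡ _)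

  mon-suc-*-suc : ∀ m a φ n → (mon (suc m) a *ₛ φ) (suc n) ≈ (mon m a *ₛ φ) n
  mon-suc-*-suc m a φ n = trans (+-congʳ (zeroˡ _)) (+-identityˡ _)

  mon-* : ∀ m n a b → (mon m a *ₛ mon n b) ≈ₛ mon (m ℕ.+ n) (a * b)
  mon-* zero    n a b k = trans (mon-0-*ˡ a (mon n b) k) (case n k)
    where
    case : ∀ n k → a * mon n b k ≈ mon n (a * b) k
    case n k with n ≡ᵇ k
    ... | true  = refl
    ... | false = zeroʳ a
  mon-* (suc m) n a b zero    = mon-suc-*-zero m a (mon n b)
  mon-* (suc m) n a b (suc k) =
    trans (mon-suc-*-suc m a (mon n b) k) (mon-* m n a b k)

  mon-0-^ : ∀ a l → (mon 0 a ^ₛ l) ≈ₛ mon 0 (a ^ l)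
  mon-0-^ a zero    = 1≈mon
  mon-0-^ a (suc l) = Sₛ.trans (Sₛ.*-congˡ {mon 0 a} (mon-0-^ a l)) (mon-* 0 0 a (a ^ l))

  mon-1-^ : ∀ a l → (mon 1 a ^ₛ l) ≈ₛ mon l (a ^ l)
  mon-1-^ a zero    = 1≈mon
  mon-1-^ a (suc l) = Sₛ.trans (Sₛ.*-congˡ {mon 1 a} (mon-1-^ a l)) (mon-* 1 l a (a ^ l))

  infixr 7 _•_
  _•_ : Carrier → Series → Series
  (a • φ) n = a * φ n

  •-* : ∀ a b φ ψ → ((a • φ) *ₛ (b • ψ)) ≈ₛ ((a * b) • (φ *ₛ ψ))
  •-* a b φ ψ n = trans
    (Σ≤-cong n (λ k _ → interchange a (φ k) b (ψ (n ∸ k))))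
    (sym (*-distribˡ-Σ≤ n (a * b) (λ k → φ k * ψ (n ∸ k))))

  -‿^ : ∀ φ l → ((-ₛ φ) ^ₛ l) ≈ₛ ((- 1#) ^ l • (φ ^ₛ l))
  -‿^ φ zero    n = sym (*-identityˡ _)
  -‿^ φ (suc l) n = trans
    (Sₛ.*-cong {u = (-ₛ φ) ^ₛ l} (λ k → sym (-1*x≈-x (φ k))) (-‿^ φ l) n)
    (•-* (- 1#) ((- 1#) ^ l) φ (φ ^ₛ l) n)
    where open RingProperties ring using (-1*x≈-x)

  Σ≤-coefficient : ∀ m (a : ℕ → Series) n →
    PowerSeries.Σ≤ seriesRing m a n ≡ Σ≤ m (λ k → a k n)
  Σ≤-coefficient zero    a n = ≡.refl
  Σ≤-coefficient (suc m) a n = ≡.cong (a 0 n +_) (Σ≤-coefficient m (λ k → a (suc k)) n)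

  -- Only l = m contributes. If m lies beyond the bound no term is left, which the hypothesis
  -- reconciles with the right side.
  Σ≤-mon : ∀ n m (a : ℕ → Carrier) → (n < m → a m ≈ 0#) →
           Σ≤ n (λ l → mon l (a l) m) ≈ a m
  Σ≤-mon zero    zero    a _     = +-identityʳ _
  Σ≤-mon zero    (suc m) a a≈0   = trans (+-identityʳ _) (sym (a≈0 (s≤s z≤n)))
  Σ≤-mon (suc n) zero    a _     = trans (+-congˡ (Σ≤-zero n (λ _ _ → refl))) (+-identityʳ _)
  Σ≤-mon (suc n) (suc m) a a≈0   = trans (+-identityˡ _)
    (Σ≤-mon n m (λ l → a (suc l)) (λ n<m → a≈0 (s≤s n<m)))

-- A[[z]][[y]][[x]]: the coefficient of x^i y^j z^k of φ is φ i j k.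
module TrivariateSeries {c ℓ} (A : CommutativeRing c ℓ) where

  A₁ A₂ A₃ : CommutativeRing c ℓ
  A₁ = SeriesProperties.seriesCommutativeRing A
  A₂ = SeriesProperties.seriesCommutativeRing A₁
  A₃ = SeriesProperties.seriesCommutativeRing A₂

  module M₁ = MonomialSeries A
  module M₂ = MonomialSeries A₁
  module M₃ = MonomialSeries A₂

  module A₁ = CommutativeRing A₁
  module A₂ = CommutativeRing A₂
  module A₃ = CommutativeRing A₃

  open CommutativeRing A using (Carrier; _≈_; _*_; trans; reflexive; rawRing)
  open PowerSeries rawRing using (Σ≤)
  open SeriesProperties A using (Σ≤-cong)

  mon₃ : ℕ → ℕ → ℕ → Carrier → A₃.Carrier
  mon₃ i j k a = M₃.mon i (M₂.mon j (M₁.mon k a))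

  mon₃-cong : ∀ i j k {a b} → a ≈ b → mon₃ i j k a A₃.≈ mon₃ i j k b
  mon₃-cong i j k a≈b = M₃.mon-cong i (M₂.mon-cong j (M₁.mon-cong k a≈b))

  mon₃-* : ∀ i j k i′ j′ k′ a b →
    (mon₃ i j k a A₃.* mon₃ i′ j′ k′ b) A₃.≈ mon₃ (i ℕ.+ i′) (j ℕ.+ j′) (k ℕ.+ k′) (a * b)
  mon₃-* i j k i′ j′ k′ a b = A₃.trans (M₃.mon-* i i′ _ _)
    (M₃.mon-cong (i ℕ.+ i′) (A₂.trans (M₂.mon-* j j′ _ _)
      (M₂.mon-cong (j ℕ.+ j′) (M₁.mon-* k k′ a b))))

  *-coefficient : ∀ φ ψ i j k → (φ A₃.* ψ) i j k ≈
    Σ≤ i (λ i′ → Σ≤ j (λ j′ → Σ≤ k (λ k′ → φ i′ j′ k′ * ψ (i ∸ i′) (j ∸ j′) (k ∸ k′))))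
  *-coefficient φ ψ i j k = trans
    (reflexive (≡.trans (≡.cong (λ χ → χ k) (M₂.Σ≤-coefficient i (λ i′ → φ i′ A₂.* ψ (i ∸ i′)) j))
      (M₁.Σ≤-coefficient i (λ i′ → (φ i′ A₂.* ψ (i ∸ i′)) j) k)))
    (Σ≤-cong i (λ i′ _ → reflexive
      (M₁.Σ≤-coefficient j (λ j′ → φ i′ j′ A₁.* ψ (i ∸ i′) (j ∸ j′)) k)))

-- Coefficients of the generating functions.

module GeneratingFunctionCoefficients {c ℓ₁ ℓ₂} (K : HeytingField c ℓ₁ ℓ₂) (char0 : CharacteristicZero K) where

  open LegendreGouldHopperSheffer K char0
  open PolynomialCoefficients K char0
  open MonomialWeights K char0
  open CommutativeRing 𝔽 hiding (zero)
  open 𝕂ₛ using (Σ≤; _^_)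
  open ≈-Reasoning setoid
  open SeriesProperties 𝔽
  open MonomialSeries 𝔽 using (_•_; •-*; -‿^; Σ≤-mon; Σ≤-coefficient)
  open RingProperties ring using (-0#≈0#; -1*x≈-x; -‿involutive)
  open CommutativeSemigroupProperties *-commutativeSemigroup using (x∙yz≈y∙xz)
  open Mult semiring using (×-homo-+; ×1-homo-*)
  open NaturalCoefficientsSolver commutativeSemiring using (solve; _:=_; _:*_)

  𝕂⟦t⟧ : CommutativeRing c ℓ₁
  𝕂⟦t⟧ = seriesCommutativeRing

  module B = TrivariateSeries 𝔽
  module T = TrivariateSeries 𝕂⟦t⟧
  private
    module Sₛ = CommutativeRing 𝕂⟦t⟧
    module P = RawRing Polyₛ.seriesRing
    module P^ = RawSemiringDefinitions (RawRing.rawSemiring Polyₛ.seriesRing)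
    module T₂^ = RawSemiringDefinitions (RawRing.rawSemiring (CommutativeRing.rawRing T.A₂))
    module T₃^ = RawSemiringDefinitions (RawRing.rawSemiring (CommutativeRing.rawRing T.A₃))
  open RawRing 𝕂ₛ.seriesRing using () renaming (_≈_ to _≈ₛ_; _*_ to _*ₛ_; 1# to 1ₛ; -_ to -ₛ_)
  open RawSemiringDefinitions (RawRing.rawSemiring 𝕂ₛ.seriesRing) using () renaming (_^_ to _^ₛ_)
  open Exp Sₛ.commutativeSemiring using (^-homo-*; ^-assocʳ)

  termCoeff≈mon₃ : ∀ a i j k → termCoeff (mono a i j k) B.A₃.≈ B.mon₃ i j k a
  termCoeff≈mon₃ a i j k i′ j′ k′ with i ≡ᵇ i′
  ... | false = refl
  ... | true with j ≡ᵇ j′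
  ...   | false = refl
  ...   | true  = refl

  -- A product of lists is a concatenation of products of terms, so distributivity among iterated
  -- series reduces the claim to monomials. Ring laws can thereafter be used on the series side.
  coeff-* : ∀ p q → coeff (p *ₚ q) B.A₃.≈ (coeff p B.A₃.* coeff q)
  coeff-* []      q = B.A₃.sym (B.A₃.zeroˡ (coeff q))
  coeff-* (τ@(mono a i j k) ∷ p) q = B.A₃.trans
    (coeff-++ (map (τ *ₜ_) q) (p *ₚ q))
    (B.A₃.trans
      (B.A₃.+-cong (term-* q) (coeff-* p q))
      (B.A₃.trans (B.A₃.sym (B.A₃.distribʳ (coeff q) (termCoeff τ) (coeff p)))
        (B.A₃.*-congʳ {coeff q} (B.A₃.sym (coeff-∷ τ p)))))
    where
    term-* : ∀ q → coeff (map (τ *ₜ_) q) B.A₃.≈ (termCoeff τ B.A₃.* coeff q)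
    term-* []      = B.A₃.sym (B.A₃.zeroʳ (termCoeff τ))
    term-* (σ@(mono b i′ j′ k′) ∷ q) = B.A₃.trans
      (coeff-∷ (τ *ₜ σ) (map (τ *ₜ_) q))
      (B.A₃.trans
        (B.A₃.+-cong
          (B.A₃.trans (termCoeff≈mon₃ (a * b) (i ℕ.+ i′) (j ℕ.+ j′) (k ℕ.+ k′))
            (B.A₃.trans (B.A₃.sym (B.mon₃-* i j k i′ j′ k′ a b))
              (B.A₃.*-cong (B.A₃.sym (termCoeff≈mon₃ a i j k)) (B.A₃.sym (termCoeff≈mon₃ b i′ j′ k′)))))
          (term-* q))
        (B.A₃.trans (B.A₃.sym (B.A₃.distribˡ (termCoeff τ) (termCoeff σ) (coeff q)))
          (B.A₃.*-congˡ {termCoeff τ} (B.A₃.sym (coeff-∷ σ q)))))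

  -- The coefficient of x^i y^j z^k as a series in t: t becomes the innermost variable.
  coeffₛ : Polyₛ.Series → T.A₃.Carrier
  coeffₛ P i j k n = coeff (P n) i j k

  -- Moving t from the outermost to the innermost position exchanges its Cauchy sum with those of x,
  -- y and z.
  coeffₛ-* : ∀ P Q → coeffₛ (P P.* Q) T.A₃.≈ (coeffₛ P T.A₃.* coeffₛ Q)
  coeffₛ-* P Q i j k n = begin
    coeff ((P P.* Q) n) i j k
      ≈⟨ coeff-Σ≤ n (λ l → P l *ₚ Q (n ∸ l)) i j k ⟩
    Σ≤ n (λ l → coeff (P l *ₚ Q (n ∸ l)) i j k)
      ≈⟨ Σ≤-cong n (λ l _ → trans (coeff-* (P l) (Q (n ∸ l)) i j k)
           (B.*-coefficient (coeff (P l)) (coeff (Q (n ∸ l))) i j k)) ⟩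
    Σ≤ n (λ l → Σ≤ i (λ i′ → Σ≤ j (λ j′ → Σ≤ k (λ k′ → a i′ j′ k′ l))))
      ≈⟨ Σ≤-swap n i (λ l i′ → Σ≤ j (λ j′ → Σ≤ k (λ k′ → a i′ j′ k′ l))) ⟩
    Σ≤ i (λ i′ → Σ≤ n (λ l → Σ≤ j (λ j′ → Σ≤ k (λ k′ → a i′ j′ k′ l))))
      ≈⟨ Σ≤-cong i (λ i′ _ → begin
           Σ≤ n (λ l → Σ≤ j (λ j′ → Σ≤ k (λ k′ → a i′ j′ k′ l)))
             ≈⟨ Σ≤-swap n j (λ l j′ → Σ≤ k (λ k′ → a i′ j′ k′ l)) ⟩
           Σ≤ j (λ j′ → Σ≤ n (λ l → Σ≤ k (λ k′ → a i′ j′ k′ l)))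
             ≈⟨ Σ≤-cong j (λ j′ _ → Σ≤-swap n k (λ l k′ → a i′ j′ k′ l)) ⟩
           Σ≤ j (λ j′ → Σ≤ k (λ k′ → b i′ j′ k′ n))
             ≈⟨ Σ≤-cong j (λ j′ _ → reflexive (Σ≤-coefficient k (b i′ j′) n)) ⟨
           Σ≤ j (λ j′ → Σ≤ₛ k (b i′ j′) n)
             ≡⟨ Σ≤-coefficient j (λ j′ → Σ≤ₛ k (b i′ j′)) n ⟨
           Σ≤ₛ j (λ j′ → Σ≤ₛ k (b i′ j′)) n ∎) ⟩
    Σ≤ i (λ i′ → Σ≤ₛ j (λ j′ → Σ≤ₛ k (b i′ j′)) n)
      ≡⟨ Σ≤-coefficient i (λ i′ → Σ≤ₛ j (λ j′ → Σ≤ₛ k (b i′ j′))) n ⟨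
    Σ≤ₛ i (λ i′ → Σ≤ₛ j (λ j′ → Σ≤ₛ k (b i′ j′))) n
      ≈⟨ T.*-coefficient (coeffₛ P) (coeffₛ Q) i j k n ⟨
    (coeffₛ P T.A₃.* coeffₛ Q) i j k n ∎
    where
    a : ℕ → ℕ → ℕ → ℕ → 𝕂
    a i′ j′ k′ l = coeff (P l) i′ j′ k′ * coeff (Q (n ∸ l)) (i ∸ i′) (j ∸ j′) (k ∸ k′)

    b : ℕ → ℕ → ℕ → Series
    b i′ j′ k′ = coeffₛ P i′ j′ k′ *ₛ coeffₛ Q (i ∸ i′) (j ∸ j′) (k ∸ k′)

    open PowerSeries 𝕂ₛ.seriesRing using () renaming (Σ≤ to Σ≤ₛ)

  mon₃-coefficient : ∀ i j k v i′ j′ k′ n →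
    T.mon₃ i j k v i′ j′ k′ n ≡ termCoeff (mono (v n) i j k) i′ j′ k′
  mon₃-coefficient i j k v i′ j′ k′ n with i ≡ᵇ i′
  ... | false = ≡.refl
  ... | true with j ≡ᵇ j′
  ...   | false = ≡.refl
  ...   | true with k ≡ᵇ k′
  ...     | false = ≡.refl
  ...     | true  = ≡.refl

  coeffₛ-monomial : ∀ v i j k → coeffₛ (λ n → mono (v n) i j k ∷ []) T.A₃.≈ T.mon₃ i j k v
  coeffₛ-monomial v i j k i′ j′ k′ n = trans
    (coeff-∷ (mono (v n) i j k) [] i′ j′ k′)
    (trans (+-identityʳ _) (reflexive (≡.sym (mon₃-coefficient i j k v i′ j′ k′ n))))

  coeffₛ-constant : ∀ i j k → coeffₛ (Polyₛ.constant (mono 1# i j k ∷ [])) T.A₃.≈ T.mon₃ i j k 1ₛ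
  coeffₛ-constant i j k i′ j′ k′ zero    = coeffₛ-monomial 1ₛ i j k i′ j′ k′ 0
  coeffₛ-constant i j k i′ j′ k′ (suc n) = trans
    (sym (trans (δ-cong i i′ (trans (δ-cong j j′ (δ-zero k k′)) (δ-zero j j′))) (δ-zero i i′)))
    (reflexive (≡.sym (mon₃-coefficient i j k 1ₛ i′ j′ k′ (suc n))))

  coeffₛ-⊖ : ∀ P → coeffₛ (P.- P) T.A₃.≈ (T.A₃.- coeffₛ P)
  coeffₛ-⊖ P i j k n = coeff-negate (P n) i j k

  coeffₛ-⊕ : ∀ P Q → coeffₛ (P P.+ Q) T.A₃.≈ (coeffₛ P T.A₃.+ coeffₛ Q)
  coeffₛ-⊕ P Q i j k n = coeff-++ (P n) (Q n) i j k

  coeffₛ-^ : ∀ P l → coeffₛ (P P^.^ l) T.A₃.≈ (coeffₛ P T₃^.^ l)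
  coeffₛ-^ P zero    = T.A₃.trans (coeffₛ-constant 0 0 0) (T.A₃.sym
    (T.A₃.trans T.M₃.1≈mon (T.M₃.mon-cong 0
      (T.A₂.trans T.M₂.1≈mon (T.M₂.mon-cong 0 T.M₁.1≈mon)))))
  coeffₛ-^ P (suc l) = T.A₃.trans (coeffₛ-* P (P P^.^ l)) (T.A₃.*-congˡ {coeffₛ P} (coeffₛ-^ P l))

  ⌈_⌉ : Series → Polyₛ.Series
  ⌈ φ ⌉ n = scalar (φ n)

  ^-cong : ∀ {φ ψ} → φ T.A₃.≈ ψ → ∀ l → (φ T₃^.^ l) T.A₃.≈ (ψ T₃^.^ l)
  ^-cong e l = Exp.^-congˡ T.A₃.commutativeSemiring l e

  -- For the arguments that occur, a monomial in x, y, z appears in exactly one power g^m, so the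
  -- sum over powers has one term. When m exceeds n the truncated sum misses it, hence the condition
  -- on h.
  ∘-coefficient : ∀ φ g i j k n m (h : ℕ → 𝕂) →
    (∀ l → (coeffₛ g T₃^.^ l) i j k n ≈ δ l m (h l)) → (n < m → h m ≈ 0#) →
    coeffₛ (⌈ φ ⌉ Polyₛ.∘ₛ g) i j k n ≈ φ m * h m
  ∘-coefficient φ g i j k n m h powers h≈0 = begin
    coeff ((⌈ φ ⌉ Polyₛ.∘ₛ g) n) i j k
      ≈⟨ coeff-Σ≤ n (λ l → scalar (φ l) *ₚ (g P^.^ l) n) i j k ⟩
    Σ≤ n (λ l → coeff (scalar (φ l) *ₚ (g P^.^ l) n) i j k)
      ≈⟨ Σ≤-cong n (λ l _ → begin
           coeff (scalar (φ l) *ₚ (g P^.^ l) n) i j k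
             ≈⟨ coeff-scalar-* (φ l) ((g P^.^ l) n) i j k ⟩
           φ l * coeff ((g P^.^ l) n) i j k
             ≈⟨ *-congˡ (trans (coeffₛ-^ g l i j k n) (powers l)) ⟩
           φ l * δ l m (h l)
             ≈⟨ *-δ l m (φ l) (h l) ⟨
           δ l m (φ l * h l) ∎) ⟩
    Σ≤ n (λ l → δ l m (φ l * h l))
      ≈⟨ Σ≤-mon n m (λ l → φ l * h l) (λ n<m → trans (*-congˡ (h≈0 n<m)) (zeroʳ _)) ⟩
    φ m * h m ∎

  -- Embeddings of series in one variable over 𝕂[[t]]. `inX` has no outer `mon 0` because x is the
  -- outermost variable.
  inX inY inZ : (ℕ → Series) → T.A₃.Carrier
  inX φ i = T.M₂.mon 0 (T.M₁.mon 0 (φ i))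
  inY φ   = T.M₃.mon 0 (λ j → T.M₁.mon 0 (φ j))
  inZ φ   = T.M₃.mon 0 (T.M₂.mon 0 φ)

  inX-coefficient : ∀ φ i j k n → inX φ i j k n ≡ δ 0 j (δ 0 k (φ i n))
  inX-coefficient φ i zero    zero    n = ≡.refl
  inX-coefficient φ i zero    (suc k) n = ≡.refl
  inX-coefficient φ i (suc j) k       n = ≡.refl

  inY-coefficient : ∀ φ i j k n → inY φ i j k n ≡ δ 0 i (δ 0 k (φ j n))
  inY-coefficient φ zero    j zero    n = ≡.refl
  inY-coefficient φ zero    j (suc k) n = ≡.refl
  inY-coefficient φ (suc i) j k       n = ≡.refl

  inZ-coefficient : ∀ φ i j k n → inZ φ i j k n ≡ δ 0 i (δ 0 j (φ k n))
  inZ-coefficient φ zero    zero    k n = ≡.refl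
  inZ-coefficient φ zero    (suc j) k n = ≡.refl
  inZ-coefficient φ (suc i) j       k n = ≡.refl

  δ-comm : ∀ l m l′ m′ a → δ l m (δ l′ m′ a) ≈ δ l′ m′ (δ l m a)
  δ-comm l m l′ m′ a with l ≡ᵇ m
  ... | true  = refl
  ... | false = sym (δ-zero l′ m′)

  δ-*² : ∀ l m l′ m′ a b → a * δ l m (δ l′ m′ b) ≈ δ l m (δ l′ m′ (a * b))
  δ-*² l m l′ m′ a b = sym (trans (δ-cong l m (*-δ l′ m′ a b)) (*-δ l m a _))

  δ²-zero : ∀ l m l′ m′ {a} → a ≈ 0# → δ l m (δ l′ m′ a) ≈ 0#
  δ²-zero l m l′ m′ a≈0 =
    trans (δ-cong l m (trans (δ-cong l′ m′ a≈0) (δ-zero l′ m′))) (δ-zero l m)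

  -- The coefficients of φ(v X) as a series in a new variable X.
  powers : Series → Series → ℕ → Series
  powers φ v l = φ l • (v ^ₛ l)

  ∘-inX : ∀ φ {g v} → v 0 ≈ 0# → coeffₛ g T.A₃.≈ T.mon₃ 1 0 0 v →
          coeffₛ (⌈ φ ⌉ Polyₛ.∘ₛ g) T.A₃.≈ inX (powers φ v)
  ∘-inX φ {g} {v} v₀≈0 g≈ i j k n = trans
    (∘-coefficient φ g i j k n i (λ l → δ 0 j (δ 0 k ((v ^ₛ l) n)))
      (λ l → trans (power l i j k n) (reflexive (mon₃-coefficient l 0 0 (v ^ₛ l) i j k n)))
      (λ n<i → δ²-zero 0 j 0 k (order-^ {v} v₀≈0 i n n<i)))
    (trans (δ-*² 0 j 0 k _ _) (reflexive (≡.sym (inX-coefficient (powers φ v) i j k n))))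
    where
    power : ∀ l → (coeffₛ g T₃^.^ l) T.A₃.≈ T.mon₃ l 0 0 (v ^ₛ l)
    power l = T.A₃.trans (^-cong g≈ l) (T.A₃.trans (T.M₃.mon-1-^ _ l)
      (T.M₃.mon-cong l (T.A₂.trans (T.M₂.mon-0-^ _ l) (T.M₂.mon-cong 0 (T.M₁.mon-0-^ v l)))))

  ∘-inY : ∀ φ {g v} → v 0 ≈ 0# → coeffₛ g T.A₃.≈ T.mon₃ 0 1 0 v →
          coeffₛ (⌈ φ ⌉ Polyₛ.∘ₛ g) T.A₃.≈ inY (powers φ v)
  ∘-inY φ {g} {v} v₀≈0 g≈ i j k n = trans
    (∘-coefficient φ g i j k n j (λ l → δ 0 i (δ 0 k ((v ^ₛ l) n)))
      (λ l → trans (power l i j k n) (trans (reflexive (mon₃-coefficient 0 l 0 (v ^ₛ l) i j k n))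
        (δ-comm 0 i l j _)))
      (λ n<j → δ²-zero 0 i 0 k (order-^ {v} v₀≈0 j n n<j)))
    (trans (δ-*² 0 i 0 k _ _) (reflexive (≡.sym (inY-coefficient (powers φ v) i j k n))))
    where
    power : ∀ l → (coeffₛ g T₃^.^ l) T.A₃.≈ T.mon₃ 0 l 0 (v ^ₛ l)
    power l = T.A₃.trans (^-cong g≈ l) (T.A₃.trans (T.M₃.mon-0-^ _ l)
      (T.M₃.mon-cong 0 (T.A₂.trans (T.M₂.mon-1-^ _ l) (T.M₂.mon-cong l (T.M₁.mon-0-^ v l)))))

  ∘-inZ : ∀ φ {g v} → v 0 ≈ 0# → coeffₛ g T.A₃.≈ T.mon₃ 0 0 1 v →
          coeffₛ (⌈ φ ⌉ Polyₛ.∘ₛ g) T.A₃.≈ inZ (powers φ v)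
  ∘-inZ φ {g} {v} v₀≈0 g≈ i j k n = trans
    (∘-coefficient φ g i j k n k (λ l → δ 0 i (δ 0 j ((v ^ₛ l) n)))
      (λ l → trans (power l i j k n) (trans (reflexive (mon₃-coefficient 0 0 l (v ^ₛ l) i j k n))
        (trans (δ-cong 0 i (δ-comm 0 j l k _)) (δ-comm 0 i l k _))))
      (λ n<k → δ²-zero 0 i 0 j (order-^ {v} v₀≈0 k n n<k)))
    (trans (δ-*² 0 i 0 j _ _) (reflexive (≡.sym (inZ-coefficient (powers φ v) i j k n))))
    where
    power : ∀ l → (coeffₛ g T₃^.^ l) T.A₃.≈ T.mon₃ 0 0 l (v ^ₛ l)
    power l = T.A₃.trans (^-cong g≈ l) (T.A₃.trans (T.M₃.mon-0-^ _ l)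
      (T.M₃.mon-cong 0 (T.A₂.trans (T.M₂.mon-0-^ _ l) (T.M₂.mon-cong 0 (T.M₁.mon-1-^ v l)))))

  ι!-*-1/! : ∀ n → ι (n !) * 1/ n ! ≈ 1#
  ι!-*-1/! zero    = trans (*-identityʳ _) (+-identityʳ 1#)
  ι!-*-1/! (suc n) = trans (*-congʳ (×1-homo-* (suc n) (n !)))
    (trans (solve 4 (λ a b q e → (a :* b) :* (q :* e) := (a :* q) :* (b :* e)) refl _ _ _ _)
      (trans (*-cong (ι-*-1/suc n) (ι!-*-1/! n)) (*-identityˡ 1#)))

  module _ (u : Series) (r : ℕ) where

    exponentYZ : ℕ → ℕ → ℕ
    exponentYZ j k = j ℕ.+ suc r ℕ.* k

    -- The exponent y u + z u^(r+1) and its exponential, which is found from the binomial theorem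
    -- instead of a functional equation for exp.
    linearYZ expYZ : T.A₂.Carrier
    linearYZ  = T.M₂.mon 1 (T.M₁.mon 0 u) T.A₂.+ T.M₂.mon 0 (T.M₁.mon 1 (u ^ₛ suc r))
    expYZ j k = (1/ j ! * 1/ k !) • (u ^ₛ exponentYZ j k)

    private
      e : ℕ → ℕ → ℕ
      e = exponentYZ

      -- This is a binomial coefficient when l = j + k. Leaving l free keeps the recursions in j and
      -- k free of side conditions; the delta in `binomial` imposes the relation.
      γ : ℕ → ℕ → ℕ → 𝕂
      γ l j k = ι (l !) * (1/ j ! * 1/ k !)

      γ-y : ∀ l j k → γ l j k ≈ ι (suc j) * γ l (suc j) k
      γ-y l j k = trans (*-congˡ (*-congʳ (1/!-suc j)))
        (solve 4 (λ a n b d → a :* ((n :* b) :* d) := n :* (a :* (b :* d))) refl _ _ _ _)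

      γ-z : ∀ l j k → γ l j k ≈ ι (suc k) * γ l j (suc k)
      γ-z l j k = trans (*-congˡ (*-congˡ (1/!-suc k)))
        (solve 4 (λ a n b d → a :* (b :* (n :* d)) := n :* (a :* (b :* d))) refl _ _ _ _)

      *-• : ∀ a φ ψ → (φ *ₛ (a • ψ)) ≈ₛ (a • (φ *ₛ ψ))
      *-• a φ ψ n = trans (Σ≤-cong n (λ k _ → x∙yz≈y∙xz (φ k) a (ψ (n ∸ k))))
        (sym (*-distribˡ-Σ≤ n a (λ k → φ k * ψ (n ∸ k))))

      δ-+ : ∀ l m a a′ → δ l m a + δ l m a′ ≈ δ l m (a + a′)
      δ-+ l m a a′ with l ≡ᵇ m
      ... | true  = refl
      ... | false = +-identityˡ 0#

      e-z : ∀ j k → suc r ℕ.+ e j k ≡ e j (suc k)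
      e-z j k = ≡.trans (x+yz≡y+xz (suc r) j _) (≡.cong (j ℕ.+_) (≡.sym (ℕₚ.*-suc (suc r) k)))
        where
        open CommutativeSemigroupProperties ℕₚ.+-commutativeSemigroup
          using () renaming (x∙yz≈y∙xz to x+yz≡y+xz)

      0-• : ∀ l m {a} φ n → a ≈ 0# → 0# ≈ (δ l m a • φ) n
      0-• l m φ n a≈0 = sym (trans (*-congʳ (trans (δ-cong l m a≈0) (δ-zero l m))) (zeroˡ (φ n)))

    -- Induction on l: the summand with y contributes j γ and the one with z contributes k γ. Under
    -- the delta their sum (j+k) γ is (l+1) γ, which is Pascal's rule because γ contains l!.
    binomial : ∀ l j k → (linearYZ T₂^.^ l) j k ≈ₛ (δ l (j ℕ.+ k) (γ l j k) • (u ^ₛ e j k))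
    binomial zero    zero    zero    n = begin
      1ₛ n
        ≈⟨ trans (*-congʳ (trans (*-cong (+-identityʳ 1#) (*-identityˡ 1#)) (*-identityˡ 1#))) (*-identityˡ _) ⟨
      γ 0 0 0 * (u ^ₛ 0) n
        ≡⟨ ≡.cong (λ m → γ 0 0 0 * (u ^ₛ m) n) (ℕₚ.*-zeroʳ (suc r)) ⟨
      γ 0 0 0 * (u ^ₛ e 0 0) n ∎
    binomial zero    zero    (suc k) n = sym (zeroˡ _)
    binomial zero    (suc j) k       n = sym (zeroˡ _)
    binomial (suc l) j       k       n = begin
      (linearYZ T.A₂.* q) j k n
        ≈⟨ T.A₂.distribʳ q (T.M₂.mon 1 (T.M₁.mon 0 u)) (T.M₂.mon 0 (T.M₁.mon 1 (u ^ₛ suc r))) j k n ⟩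
      (T.M₂.mon 1 (T.M₁.mon 0 u) T.A₂.* q) j k n + (T.M₂.mon 0 (T.M₁.mon 1 (u ^ₛ suc r)) T.A₂.* q) j k n
        ≈⟨ +-cong (yPart j k n) (zPart j k n) ⟩
      δ (suc l) (j ℕ.+ k) (ι j * γ l j k) * U n + δ (suc l) (j ℕ.+ k) (ι k * γ l j k) * U n
        ≈⟨ distribʳ _ _ _ ⟨
      (δ (suc l) (j ℕ.+ k) (ι j * γ l j k) + δ (suc l) (j ℕ.+ k) (ι k * γ l j k)) * U n
        ≈⟨ *-congʳ (δ-+ (suc l) (j ℕ.+ k) _ _) ⟩
      δ (suc l) (j ℕ.+ k) (ι j * γ l j k + ι k * γ l j k) * U n
        ≈⟨ *-congʳ (δ-cong (suc l) (j ℕ.+ k)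
             (trans (*-congʳ (×-homo-+ 1# j k)) (distribʳ _ _ _))) ⟨
      δ (suc l) (j ℕ.+ k) (ι (j ℕ.+ k) * γ l j k) * U n
        ≈⟨ *-congʳ (δ-subst (suc l) (j ℕ.+ k) (λ m → ι m * γ l j k)) ⟨
      δ (suc l) (j ℕ.+ k) (ι (suc l) * γ l j k) * U n
        ≈⟨ *-congʳ (δ-cong (suc l) (j ℕ.+ k)
             (trans (*-congʳ (×1-homo-* (suc l) (l !))) (*-assoc _ _ _))) ⟨
      δ (suc l) (j ℕ.+ k) (γ (suc l) j k) * U n ∎
      where
      q : T.A₂.Carrier
      q = linearYZ T₂^.^ l

      U : Series
      U = u ^ₛ e j k

      yPart : ∀ j k → (T.M₂.mon 1 (T.M₁.mon 0 u) T.A₂.* q) j k ≈ₛ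
                      (δ (suc l) (j ℕ.+ k) (ι j * γ l j k) • (u ^ₛ e j k))
      yPart zero    k n = trans (T.M₂.mon-suc-*-zero 0 (T.M₁.mon 0 u) q k n)
        (0-• (suc l) k (u ^ₛ e 0 k) n (zeroˡ _))
      yPart (suc j) k n = begin
        (T.M₂.mon 1 (T.M₁.mon 0 u) T.A₂.* q) (suc j) k n
          ≈⟨ T.M₂.mon-suc-*-suc 0 (T.M₁.mon 0 u) q j k n ⟩
        (T.M₂.mon 0 (T.M₁.mon 0 u) T.A₂.* q) j k n
          ≈⟨ T.M₂.mon-0-*ˡ (T.M₁.mon 0 u) q j k n ⟩
        (T.M₁.mon 0 u T.A₁.* q j) k n
          ≈⟨ T.M₁.mon-0-*ˡ u (q j) k n ⟩
        (u *ₛ q j k) n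
          ≈⟨ Sₛ.*-congˡ {u} (binomial l j k) n ⟩
        (u *ₛ (δ l (j ℕ.+ k) (γ l j k) • (u ^ₛ e j k))) n
          ≈⟨ *-• _ u (u ^ₛ e j k) n ⟩
        δ l (j ℕ.+ k) (γ l j k) * (u ^ₛ suc (e j k)) n
          ≈⟨ *-congʳ (δ-cong l (j ℕ.+ k) (γ-y l j k)) ⟩
        δ (suc l) (suc j ℕ.+ k) (ι (suc j) * γ l (suc j) k) * (u ^ₛ e (suc j) k) n ∎

      zPart : ∀ j k → (T.M₂.mon 0 (T.M₁.mon 1 (u ^ₛ suc r)) T.A₂.* q) j k ≈ₛ
                      (δ (suc l) (j ℕ.+ k) (ι k * γ l j k) • (u ^ₛ e j k))
      zPart j zero    n = trans (T.M₂.mon-0-*ˡ (T.M₁.mon 1 (u ^ₛ suc r)) q j 0 n)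
        (trans (T.M₁.mon-suc-*-zero 0 (u ^ₛ suc r) (q j) n)
          (0-• (suc l) (j ℕ.+ 0) (u ^ₛ e j 0) n (zeroˡ _)))
      zPart j (suc k) n = begin
        (T.M₂.mon 0 (T.M₁.mon 1 (u ^ₛ suc r)) T.A₂.* q) j (suc k) n
          ≈⟨ T.M₂.mon-0-*ˡ (T.M₁.mon 1 (u ^ₛ suc r)) q j (suc k) n ⟩
        (T.M₁.mon 1 (u ^ₛ suc r) T.A₁.* q j) (suc k) n
          ≈⟨ T.M₁.mon-suc-*-suc 0 (u ^ₛ suc r) (q j) k n ⟩
        (T.M₁.mon 0 (u ^ₛ suc r) T.A₁.* q j) k n
          ≈⟨ T.M₁.mon-0-*ˡ (u ^ₛ suc r) (q j) k n ⟩
        ((u ^ₛ suc r) *ₛ q j k) n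
          ≈⟨ Sₛ.*-congˡ {u ^ₛ suc r} (binomial l j k) n ⟩
        ((u ^ₛ suc r) *ₛ (δ l (j ℕ.+ k) (γ l j k) • (u ^ₛ e j k))) n
          ≈⟨ *-• _ (u ^ₛ suc r) (u ^ₛ e j k) n ⟩
        δ l (j ℕ.+ k) (γ l j k) * ((u ^ₛ suc r) *ₛ (u ^ₛ e j k)) n
          ≈⟨ *-cong (δ-cong l (j ℕ.+ k) (γ-z l j k)) (sym (^-homo-* u (suc r) (e j k) n)) ⟩
        δ (suc l) (suc (j ℕ.+ k)) (ι (suc k) * γ l j (suc k)) * (u ^ₛ (suc r ℕ.+ e j k)) n
          ≡⟨ ≡.cong₂ (λ m m′ → δ (suc l) m (ι (suc k) * γ l j (suc k)) * (u ^ₛ m′) n)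
               (≡.sym (ℕₚ.+-suc j k)) (e-z j k) ⟩
        δ (suc l) (j ℕ.+ suc k) (ι (suc k) * γ l j (suc k)) * (u ^ₛ e j (suc k)) n ∎

    ∘-expYZ : u 0 ≈ 0# → ∀ {g} → coeffₛ g T.A₃.≈ T.M₃.mon 0 linearYZ →
              coeffₛ (⌈ expSeries ⌉ Polyₛ.∘ₛ g) T.A₃.≈ T.M₃.mon 0 expYZ
    ∘-expYZ u₀≈0 {g} g≈ i j k n = begin
      coeffₛ (⌈ expSeries ⌉ Polyₛ.∘ₛ g) i j k n
        ≈⟨ ∘-coefficient expSeries g i j k n (j ℕ.+ k) h power vanish ⟩
      1/ j ℕ.+ k ! * h (j ℕ.+ k)
        ≈⟨ *-δ 0 i _ _ ⟨
      δ 0 i (1/ j ℕ.+ k ! * (γ (j ℕ.+ k) j k * (u ^ₛ e j k) n))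
        ≈⟨ δ-cong 0 i (trans
             (solve 4 (λ q f d v → q :* ((f :* d) :* v) := (f :* q) :* (d :* v)) refl _ _ _ _)
             (trans (*-congʳ (ι!-*-1/! (j ℕ.+ k))) (*-identityˡ _))) ⟩
      δ 0 i (expYZ j k n)
        ≡⟨ mon-0 i expYZ ⟨
      T.M₃.mon 0 expYZ i j k n ∎
      where
      h : ℕ → 𝕂
      h l = δ 0 i (γ l j k * (u ^ₛ e j k) n)

      mon-0 : ∀ i (φ : T.A₂.Carrier) → T.M₃.mon 0 φ i j k n ≡ δ 0 i (φ j k n)
      mon-0 zero    φ = ≡.refl
      mon-0 (suc i) φ = ≡.refl

      power : ∀ l → (coeffₛ g T₃^.^ l) i j k n ≈ δ l (j ℕ.+ k) (h l)
      power l = begin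
        (coeffₛ g T₃^.^ l) i j k n
          ≈⟨ ^-cong g≈ l i j k n ⟩
        (T.M₃.mon 0 linearYZ T₃^.^ l) i j k n
          ≈⟨ T.M₃.mon-0-^ linearYZ l i j k n ⟩
        T.M₃.mon 0 (linearYZ T₂^.^ l) i j k n
          ≡⟨ mon-0 i (linearYZ T₂^.^ l) ⟩
        δ 0 i ((linearYZ T₂^.^ l) j k n)
          ≈⟨ δ-cong 0 i (binomial l j k n) ⟩
        δ 0 i (δ l (j ℕ.+ k) (γ l j k) * (u ^ₛ e j k) n)
          ≈⟨ δ-cong 0 i (trans (*-comm _ _) (trans (sym (*-δ l (j ℕ.+ k) _ _))
               (δ-cong l (j ℕ.+ k) (*-comm _ _)))) ⟩
        δ 0 i (δ l (j ℕ.+ k) (γ l j k * (u ^ₛ e j k) n))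
          ≈⟨ δ-comm 0 i l (j ℕ.+ k) _ ⟩
        δ l (j ℕ.+ k) (h l) ∎

      -- The exponent `suc r` is positive, so j + k ≤ j + (r+1)k and this power of u has order above
      -- n.
      vanish : n < j ℕ.+ k → h (j ℕ.+ k) ≈ 0#
      vanish n<j+k = trans (δ-cong 0 i (trans (*-congˡ (order-^ {u} u₀≈0 (e j k) n
        (ℕₚ.<-≤-trans n<j+k (ℕₚ.+-monoʳ-≤ j (ℕₚ.m≤m+n k (r ℕ.* k)))))) (zeroʳ _))) (δ-zero 0 i)

  coeffₛ-⌈⌉^ : ∀ u m → coeffₛ (⌈ u ⌉ P^.^ m) T.A₃.≈ T.mon₃ 0 0 0 (u ^ₛ m)
  coeffₛ-⌈⌉^ u m = T.A₃.trans (coeffₛ-^ ⌈ u ⌉ m)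
    (T.A₃.trans (^-cong (coeffₛ-monomial u 0 0 0) m)
      (T.A₃.trans (T.M₃.mon-0-^ _ m) (T.M₃.mon-cong 0
        (T.A₂.trans (T.M₂.mon-0-^ _ m) (T.M₂.mon-cong 0 (T.M₁.mon-0-^ u m))))))

  coeffₛ-constant-* : ∀ i j k {Q v} → coeffₛ Q T.A₃.≈ T.mon₃ 0 0 0 v →
    coeffₛ (Polyₛ.constant (mono 1# i j k ∷ []) P.* Q) T.A₃.≈ T.mon₃ i j k v
  coeffₛ-constant-* i j k {Q} {v} Q≈ = T.A₃.trans
    (coeffₛ-* (Polyₛ.constant (mono 1# i j k ∷ [])) Q)
    (T.A₃.trans (T.A₃.*-cong (coeffₛ-constant i j k) Q≈)
      (T.A₃.trans (T.A₃.*-comm (T.mon₃ i j k 1ₛ) (T.mon₃ 0 0 0 v))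
        (T.A₃.trans (T.mon₃-* 0 0 0 i j k v 1ₛ) (T.mon₃-cong i j k (Sₛ.*-identityʳ v)))))

  coeffₛ-⊖-mon₃ : ∀ i j k {P v} → coeffₛ P T.A₃.≈ T.mon₃ i j k v →
    coeffₛ (P.- P) T.A₃.≈ T.mon₃ i j k (-ₛ v)
  coeffₛ-⊖-mon₃ i j k {P} P≈ = T.A₃.trans (coeffₛ-⊖ P) (T.A₃.trans (T.A₃.-‿cong P≈)
    (T.A₃.trans (T.M₃.mon-negate i _) (T.M₃.mon-cong i
      (T.A₂.trans (T.M₂.mon-negate j _) (T.M₂.mon-cong j (T.M₁.mon-negate k _))))))

  -- The sign (-1)^n of C₀ meets the equal sign of the power of -φ, and their product is 1.
  C₀-sign : ∀ n φ → (C₀ n • ((-ₛ φ) ^ₛ n)) ≈ₛ ((1/ n ! * 1/ n !) • (φ ^ₛ n))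
  C₀-sign n φ m = begin
    (s * d) * ((-ₛ φ) ^ₛ n) m
      ≈⟨ *-congˡ (-‿^ φ n m) ⟩
    (s * d) * (s * (φ ^ₛ n) m)
      ≈⟨ solve 3 (λ s d v → (s :* d) :* (s :* v) := (s :* s) :* (d :* v)) refl _ _ _ ⟩
    (s * s) * (d * (φ ^ₛ n) m)
      ≈⟨ trans (*-congʳ (sign² n)) (*-identityˡ _) ⟩
    d * (φ ^ₛ n) m ∎
    where
    s d : 𝕂
    s = (- 1#) ^ n
    d = 1/ n ! * 1/ n !

    sign² : ∀ n → (- 1#) ^ n * (- 1#) ^ n ≈ 1#
    sign² zero    = *-identityˡ 1#
    sign² (suc n) = trans
      (solve 2 (λ a b → (a :* b) :* (a :* b) := (a :* a) :* (b :* b)) refl (- 1#) ((- 1#) ^ n))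
      (trans (*-cong (trans (-1*x≈-x (- 1#)) (-‿involutive 1#)) (sign² n)) (*-identityˡ 1#))

  module _ {u : Series} (u₀≈0 : u 0 ≈ 0#) (r : ℕ) where

    private
      negate₀ : ∀ {a} → a ≈ 0# → - a ≈ 0#
      negate₀ a≈0 = trans (-‿cong a≈0) -0#≈0#

    -- This is G = H(u) read coefficientwise. One factor involves only x and the other only y and z,
    -- so the Cauchy sums in x, y, z collapse and only a product of series in t remains.
    sLeG-gf-coefficient : ∀ n i j k →
      coeff (sLeG-gf (suc r) u n) i j k ≈ weightˢ i j k * (u ^ₛ degreeˢ (suc r) i j k) n
    sLeG-gf-coefficient n i j k = begin
      coeffₛ (sLeG-gf (suc r) u) i j k n
        ≈⟨ coeffₛ-* (⌈ C₀ ⌉ Polyₛ.∘ₛ gC) (⌈ expSeries ⌉ Polyₛ.∘ₛ gE) i j k n ⟩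
      (coeffₛ (⌈ C₀ ⌉ Polyₛ.∘ₛ gC) T.A₃.* coeffₛ (⌈ expSeries ⌉ Polyₛ.∘ₛ gE)) i j k n
        ≈⟨ T.A₃.*-cong (∘-inX C₀ {gC} (negate₀ (order-^ {u} u₀≈0 2 0 (s≤s z≤n))) gC≈)
             (∘-expYZ u r u₀≈0 {gE} gE≈) i j k n ⟩
      (inX c₁ T.A₃.* T.M₃.mon 0 (expYZ u r)) i j k n
        ≈⟨ T.M₃.mon-0-*ʳ (inX c₁) (expYZ u r) i j k n ⟩
      (T.M₂.mon 0 (T.M₁.mon 0 (c₁ i)) T.A₂.* expYZ u r) j k n
        ≈⟨ T.M₂.mon-0-*ˡ (T.M₁.mon 0 (c₁ i)) (expYZ u r) j k n ⟩
      (T.M₁.mon 0 (c₁ i) T.A₁.* expYZ u r j) k n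
        ≈⟨ T.M₁.mon-0-*ˡ (c₁ i) (expYZ u r j) k n ⟩
      (c₁ i *ₛ expYZ u r j k) n
        ≈⟨ Sₛ.*-congʳ {expYZ u r j k} (C₀-sign i (u ^ₛ 2)) n ⟩
      (((1/ i ! * 1/ i !) • ((u ^ₛ 2) ^ₛ i)) *ₛ expYZ u r j k) n
        ≈⟨ •-* (1/ i ! * 1/ i !) (1/ j ! * 1/ k !) ((u ^ₛ 2) ^ₛ i) (u ^ₛ exponentYZ u r j k) n ⟩
      weightˢ i j k * (((u ^ₛ 2) ^ₛ i) *ₛ (u ^ₛ exponentYZ u r j k)) n
        ≈⟨ *-congˡ (Sₛ.*-congʳ {u ^ₛ exponentYZ u r j k} (^-assocʳ u 2 i) n) ⟩
      weightˢ i j k * ((u ^ₛ (2 ℕ.* i)) *ₛ (u ^ₛ exponentYZ u r j k)) n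
        ≈⟨ *-congˡ (^-homo-* u (2 ℕ.* i) (exponentYZ u r j k) n) ⟨
      weightˢ i j k * (u ^ₛ (2 ℕ.* i ℕ.+ exponentYZ u r j k)) n
        ≡⟨ ≡.cong (λ m → weightˢ i j k * (u ^ₛ (i ℕ.+ m ℕ.+ exponentYZ u r j k)) n) (ℕₚ.+-identityʳ i) ⟩
      weightˢ i j k * (u ^ₛ degreeˢ (suc r) i j k) n ∎
      where
      gC gE : Polyₛ.Series
      gC = P.- (Polyₛ.constant x P.* (⌈ u ⌉ P^.^ 2))
      gE = (Polyₛ.constant y P.* ⌈ u ⌉) P.+ (Polyₛ.constant z P.* (⌈ u ⌉ P^.^ suc r))

      c₁ : ℕ → Series
      c₁ = powers C₀ (-ₛ (u ^ₛ 2))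

      gC≈ : coeffₛ gC T.A₃.≈ T.mon₃ 1 0 0 (-ₛ (u ^ₛ 2))
      gC≈ = coeffₛ-⊖-mon₃ 1 0 0 {Polyₛ.constant x P.* (⌈ u ⌉ P^.^ 2)}
        (coeffₛ-constant-* 1 0 0 {⌈ u ⌉ P^.^ 2} (coeffₛ-⌈⌉^ u 2))

      gE≈ : coeffₛ gE T.A₃.≈ T.M₃.mon 0 (linearYZ u r)
      gE≈ = T.A₃.trans (coeffₛ-⊕ (Polyₛ.constant y P.* ⌈ u ⌉) (Polyₛ.constant z P.* (⌈ u ⌉ P^.^ suc r)))
        (T.A₃.trans (T.A₃.+-cong
          (coeffₛ-constant-* 0 1 0 {⌈ u ⌉} (coeffₛ-monomial u 0 0 0))
          (coeffₛ-constant-* 0 0 1 {⌈ u ⌉ P^.^ suc r} (coeffₛ-⌈⌉^ u (suc r))))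
          (T.M₃.mon-+ 0 _ _))

    rLeG-gf-coefficient : ∀ n i j k →
      coeff (rLeG-gf (suc r) u n) i j k ≈ weightʳ i j k * (u ^ₛ degreeʳ (suc r) i j k) n
    rLeG-gf-coefficient n i j k = begin
      coeffₛ (rLeG-gf (suc r) u) i j k n
        ≈⟨ T.A₃.trans (coeffₛ-* ((⌈ C₀ ⌉ Polyₛ.∘ₛ gX) P.* (⌈ C₀ ⌉ Polyₛ.∘ₛ gY)) (⌈ expSeries ⌉ Polyₛ.∘ₛ gZ))
             (T.A₃.*-congʳ {coeffₛ (⌈ expSeries ⌉ Polyₛ.∘ₛ gZ)}
               (coeffₛ-* (⌈ C₀ ⌉ Polyₛ.∘ₛ gX) (⌈ C₀ ⌉ Polyₛ.∘ₛ gY))) i j k n ⟩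
      (coeffₛ (⌈ C₀ ⌉ Polyₛ.∘ₛ gX) T.A₃.* coeffₛ (⌈ C₀ ⌉ Polyₛ.∘ₛ gY)
        T.A₃.* coeffₛ (⌈ expSeries ⌉ Polyₛ.∘ₛ gZ)) i j k n
        ≈⟨ T.A₃.*-cong (T.A₃.*-cong
               (∘-inX C₀ {gX} u₀≈0 (coeffₛ-constant-* 1 0 0 {⌈ u ⌉} (coeffₛ-monomial u 0 0 0)))
               (∘-inY C₀ {gY} (negate₀ u₀≈0) (coeffₛ-⊖-mon₃ 0 1 0 {Polyₛ.constant y P.* ⌈ u ⌉}
                 (coeffₛ-constant-* 0 1 0 {⌈ u ⌉} (coeffₛ-monomial u 0 0 0)))))
             (∘-inZ expSeries {gZ} (order-^ {u} u₀≈0 (suc r) 0 (s≤s z≤n))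
               (coeffₛ-constant-* 0 0 1 {⌈ u ⌉ P^.^ suc r} (coeffₛ-⌈⌉^ u (suc r)))) i j k n ⟩
      (inX c₁ T.A₃.* inY c₂ T.A₃.* inZ c₃) i j k n
        -- The factors in y and z are grouped since their product is constant in x, and such a
        -- series multiplies each coefficient of x^i separately.
        ≈⟨ T.A₃.*-assoc (inX c₁) (inY c₂) (inZ c₃) i j k n ⟩
      (inX c₁ T.A₃.* (inY c₂ T.A₃.* inZ c₃)) i j k n
        ≈⟨ T.A₃.*-congˡ {inX c₁} (T.M₃.mon-* 0 0 (λ j → T.M₁.mon 0 (c₂ j)) (T.M₂.mon 0 c₃)) i j k n ⟩
      (inX c₁ T.A₃.* T.M₃.mon 0 yz) i j k n
        ≈⟨ T.M₃.mon-0-*ʳ (inX c₁) yz i j k n ⟩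
      (T.M₂.mon 0 (T.M₁.mon 0 (c₁ i)) T.A₂.* yz) j k n
        ≈⟨ T.M₂.mon-0-*ˡ (T.M₁.mon 0 (c₁ i)) yz j k n ⟩
      (T.M₁.mon 0 (c₁ i) T.A₁.* yz j) k n
        ≈⟨ T.M₁.mon-0-*ˡ (c₁ i) (yz j) k n ⟩
      (c₁ i *ₛ yz j k) n
        ≈⟨ Sₛ.*-congˡ {c₁ i} (Sₛ.trans (T.M₂.mon-0-*ʳ (λ j → T.M₁.mon 0 (c₂ j)) c₃ j k)
             (T.M₁.mon-0-*ˡ (c₂ j) c₃ k)) n ⟩
      (c₁ i *ₛ (c₂ j *ₛ c₃ k)) n
        ≈⟨ Sₛ.*-congˡ {c₁ i} (Sₛ.*-congʳ {c₃ k} (C₀-sign j u)) n ⟩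
      (c₁ i *ₛ (((1/ j ! * 1/ j !) • (u ^ₛ j)) *ₛ c₃ k)) n
        ≈⟨ Sₛ.*-congˡ {c₁ i} (•-* (1/ j ! * 1/ j !) (1/ k !) (u ^ₛ j) ((u ^ₛ suc r) ^ₛ k)) n ⟩
      (c₁ i *ₛ ((1/ j ! * 1/ j ! * 1/ k !) • ((u ^ₛ j) *ₛ ((u ^ₛ suc r) ^ₛ k)))) n
        ≈⟨ •-* (C₀ i) (1/ j ! * 1/ j ! * 1/ k !) (u ^ₛ i) ((u ^ₛ j) *ₛ ((u ^ₛ suc r) ^ₛ k)) n ⟩
      C₀ i * (1/ j ! * 1/ j ! * 1/ k !) * ((u ^ₛ i) *ₛ ((u ^ₛ j) *ₛ ((u ^ₛ suc r) ^ₛ k))) n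
        ≈⟨ *-cong (sym (*-assoc _ _ _)) (Sₛ.*-congˡ {u ^ₛ i} exponents n) ⟩
      weightʳ i j k * ((u ^ₛ i) *ₛ (u ^ₛ (j ℕ.+ suc r ℕ.* k))) n
        ≈⟨ *-congˡ (^-homo-* u i (j ℕ.+ suc r ℕ.* k) n) ⟨
      weightʳ i j k * (u ^ₛ degreeʳ (suc r) i j k) n ∎
      where
      gX gY gZ : Polyₛ.Series
      gX = Polyₛ.constant x P.* ⌈ u ⌉
      gY = P.- (Polyₛ.constant y P.* ⌈ u ⌉)
      gZ = Polyₛ.constant z P.* (⌈ u ⌉ P^.^ suc r)

      c₁ c₂ c₃ : ℕ → Series
      c₁ = powers C₀ u
      c₂ = powers C₀ (-ₛ u)
      c₃ = powers expSeries (u ^ₛ suc r)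

      yz : T.A₂.Carrier
      yz = (λ j → T.M₁.mon 0 (c₂ j)) T.A₂.* T.M₂.mon 0 c₃

      exponents : ((u ^ₛ j) *ₛ ((u ^ₛ suc r) ^ₛ k)) ≈ₛ (u ^ₛ (j ℕ.+ suc r ℕ.* k))
      exponents = Sₛ.trans (Sₛ.*-congˡ {u ^ₛ j} (^-assocʳ u (suc r) k))
        (Sₛ.sym (^-homo-* u j (suc r ℕ.* k)))

-- Both families as eigenvectors with eigenvalue n.

corollary2p4 : ∀ {c ℓ₁ ℓ₂} (K : HeytingField c ℓ₁ ℓ₂) (char0 : CharacteristicZero K) →
    let open LegendreGouldHopperSheffer K char0 in
    (f f⁻¹ 1/f′ : Series) →
    IsDelta f →
    IsCompositionalInverse f f⁻¹ →
    IsReciprocal (𝕂ₛ.derivative f) 1/f′ →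
    (r : ℕ) → 1 ≤ r → (n : ℕ) →
    SLeGEquation f 1/f′ r n (sLeG r f⁻¹ n)
    × RLeGEquation f 1/f′ r n (rLeG r f⁻¹ n)
    × RLeGEquation f 1/f′ r n (scalar (1/ n !) *ₚ rLeG r f⁻¹ n)
corollary2p4 K char0 f u 1/f′ _ (u₀≈0 , fu≈t , _) f′/f′≈1 (suc r) _ n =
    S.eigenvector {u} u₀≈0 (ι (n !)) n {f} {1/f′} {∂y} {∂y} {sLeG-M (suc r)} fu≈t f′/f′≈1
      ∂y-loweringˢ ∂y-lowersDegree ∂y-loweringˢ ∂y-lowersDegree raisingˢ {sLeG (suc r) u n}
      (S.weighted λ i j k → begin
        coeff (sLeG (suc r) u n) i j k
          ≈⟨ coeff-·ₚ (n !) (sLeG-gf (suc r) u n) i j k ⟩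
        (n !) · coeff (sLeG-gf (suc r) u n) i j k
          ≈⟨ ·≈ι* (n !) _ ⟩
        ι (n !) * coeff (sLeG-gf (suc r) u n) i j k
          ≈⟨ *-congˡ (sLeG-gf-coefficient {u} u₀≈0 r n i j k) ⟩
        ι (n !) * (weightˢ i j k * _)
          ≈⟨ x∙yz≈y∙xz _ _ _ ⟩
        weightˢ i j k * (ι (n !) * _) ∎)
  -- The two normalisations of the second family are multiples of the same coefficient of t^n, by
  -- (n!)² and by (n!)²/n!.
  , solution (ι (n ! ℕ.* n !)) (rLeG (suc r) u n) rLeG-coefficient
  , solution (1/ n ! * ι (n ! ℕ.* n !)) (scalar (1/ n !) *ₚ rLeG (suc r) u n) (λ i j k → begin
      coeff (scalar (1/ n !) *ₚ rLeG (suc r) u n) i j k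
        ≈⟨ coeff-scalar-* (1/ n !) (rLeG (suc r) u n) i j k ⟩
      1/ n ! * coeff (rLeG (suc r) u n) i j k
        ≈⟨ *-congˡ (rLeG-coefficient i j k) ⟩
      1/ n ! * (ι (n ! ℕ.* n !) * coeff (rLeG-gf (suc r) u n) i j k)
        ≈⟨ *-assoc _ _ _ ⟨
      1/ n ! * ι (n ! ℕ.* n !) * coeff (rLeG-gf (suc r) u n) i j k ∎)
  where
  open LegendreGouldHopperSheffer K char0
  open PolynomialCoefficients K char0
  open MonomialWeights K char0
  open LegendreOperators K char0 r
  open GeneratingFunctionCoefficients K char0
  open CommutativeRing 𝔽 using (_≈_; _*_; setoid; trans; *-congˡ; *-assoc; *-commutativeSemigroup)
  open CommutativeSemigroupProperties *-commutativeSemigroup using (x∙yz≈y∙xz)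
  open 𝕂ₛ using (_·_)
  open ≈-Reasoning setoid

  rLeG-coefficient : ∀ i j k →
    coeff (rLeG (suc r) u n) i j k ≈ ι (n ! ℕ.* n !) * coeff (rLeG-gf (suc r) u n) i j k
  rLeG-coefficient i j k = trans
    (coeff-·ₚ (n ! ℕ.* n !) (rLeG-gf (suc r) u n) i j k) (·≈ι* (n ! ℕ.* n !) _)

  -- The equation is linear in p, so any multiple s of the coefficient of t^n in the generating
  -- function solves it.
  solution : ∀ s p → (∀ i j k → coeff p i j k ≈ s * coeff (rLeG-gf (suc r) u n) i j k) →
             RLeGEquation f 1/f′ (suc r) n p
  solution s p p≈ = R.eigenvector {u} u₀≈0 s n {f} {1/f′} {λ q → -ₚ ∂/∂Dx⁻¹ q} {∂/∂Dy⁻¹} {rLeG-M (suc r)}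
    fu≈t f′/f′≈1
    -∂/∂Dx⁻¹-loweringʳ -∂/∂Dx⁻¹-lowersDegree ∂/∂Dy⁻¹-loweringʳ ∂/∂Dy⁻¹-lowersDegree raisingʳ {p}
    (R.weighted λ i j k → trans (p≈ i j k)
      (trans (*-congˡ (rLeG-gf-coefficient {u} u₀≈0 r n i j k)) (x∙yz≈y∙xz _ _ _)))
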